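{- Let $\Sigma$ be a finite alphabet. If a language $L\subseteq\Sigma^\omega$ is $\omega$-regular and (edge-labelled) positional, then $L$ is $\omega$-star-free.
   Context: **Games.** An edge-labelled arena is a tuple $(V_1,V_2,\delta)$ where $V_1,V_2$ are disjoint finite sets of states controlled by Player 1 and Player 2, $V=V_1\sqcup V_2$, and $\delta\subseteq V\times\Sigma\times V$ is total (every state has at least one outgoing edge). For $e=(v,c,v')\in\delta$ write $src(e)=v$, $col(e)=c$, $tgt(e)=v'$. A strategy is a function $\sigma:V\cup\delta^+\to\delta$ with $src(\sigma(v))=v$ for $v\in V$ and $src(\sigma(we))=tgt(e)$ for $w\in\delta^*$, $e\in\delta$. A positional strategy is a function $\sigma:V\to\delta$ with $src(\sigma(v))=v$ (the move depends only on the current state). Strategies $\sigma_1,\sigma_2$ and an initial state $q$ determine a play $\varsigma\in\delta^\omega$: at each step, if the current state lies in $V_i$, the next edge is the one given by $\sigma_i$ applied to the history of edges so far (to $q$ at the first step; to the current state if $\sigma_i$ is positional). Its trace is the word $col(\varsigma[0])col(\varsigma[1])\cdots\in\Sigma^\omega$. For an objective $L\subseteq\Sigma^\omega$, a strategy $\sigma_1$ is winning for Player 1 from $q$ if for every strategy $\sigma_2$ the trace of the play from $q$ lies in $L$. **Positionality.** $L$ is (edge-labelled) positional if for every edge-labelled arena, every $W\subseteq V$, and every strategy that is winning for Player 1 (objective $L$) from all states of $W$, there is a single positional strategy that is winning for Player 1 from all states of $W$. **$\omega$-star-free.** $L\subseteq\Sigma^\omega$ is $\omega$-star-free if it is recognised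 by a finite aperiodic monoid: there are a finite monoid $M$ such that for each $x\in M$ there is $n$ with $x^n=x^{n+1}$, and a monoid homomorphism $h:\Sigma^*\to M$, such that whenever $w=w_0w_1\cdots$ and $w'=w_0'w_1'\cdots$ with $w_i,w_i'\in\Sigma^+$ and $h(w_i)=h(w_i')$ for all $i$, then $w\in L\iff w'\in L$. Equivalently, $L$ is definable by a formula of linear-time temporal logic over $\Sigma$. -}

module Defs where

open import Algebra.Bundles using (Monoid)
import Algebra.Definitions.RawMonoid as RawMonoidDefinitions
open import Algebra.Morphism.Structures using (module MonoidMorphisms)
open import Data.Bool.Base using (Bool; T)
open import Data.Fin.Base using (Fin)
open import Data.List.Base using (List; []; _∷_; [_]; _++_; ++-[]-rawMonoid)
open import Data.List.NonEmpty.Base using (List⁺; _∷_; head; toList)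
open import Data.Nat.Base using (ℕ; zero; suc; _≤_)
open import Data.Product.Base using (∃; ∃-syntax; _×_; _,_)
open import Data.Sum.Base using (_⊎_; inj₁; inj₂)
open import Function.Base using (_∘_)
open import Function.Bundles using (Inverse; _↔_; _⇔_)
open import Level using (0ℓ)
open import Relation.Binary.Bundles using (Setoid)
open import Relation.Binary.PropositionalEquality using (_≡_; _≗_; setoid)
open import Relation.Unary using (Pred)

Finite : Set → Set
Finite A = ∃[ n ] (A ↔ Fin n)

FiniteSetoid : Setoid 0ℓ 0ℓ → Set
FiniteSetoid S = ∃[ n ] Inverse S (setoid (Fin n))

-- Subsets of finite sets (edges of an arena, sets of initial states, ...) are
-- given by characteristic functions; languages of infinite words are arbitrary
-- predicates.

Subset : Set → Set
Subset A = A → Bool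

infix 4 _∈_

_∈_ : {A : Set} → A → Subset A → Set
x ∈ S = T (S x)

ωWord : Set → Set
ωWord Σ = ℕ → Σ

ωLanguage : Set → Set₁
ωLanguage Σ = Pred (ωWord Σ) 0ℓ

------------------------------------------------------------------------
-- ω-regular languages

record BüchiAutomaton (Σ : Set) : Set₁ where
  field
    Q         : Set
    Q-finite  : Finite Q
    Δ         : Subset (Q × Σ × Q)
    initial   : Subset Q
    accepting : Subset Q

  record AcceptingRun (w : ωWord Σ) : Set where
    field
      run       : ℕ → Q
      starts    : run 0 ∈ initial
      steps     : ∀ i → (run i , w i , run (suc i)) ∈ Δ
      recurrent : ∀ i → ∃[ j ] (i ≤ j × run j ∈ accepting)

ωRegular : {Σ : Set} → ωLanguage Σ → Set₁
ωRegular {Σ} L =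
  ∃ λ (A : BüchiAutomaton Σ) → ∀ w → L w ⇔ BüchiAutomaton.AcceptingRun A w

------------------------------------------------------------------------
-- Games

record Arena (Σ : Set) : Set₁ where
  field
    V₁ V₂     : Set
    V₁-finite : Finite V₁
    V₂-finite : Finite V₂

  V : Set
  V = V₁ ⊎ V₂

  field
    δ     : Subset (V × Σ × V)
    total : ∀ v → ∃[ c ] ∃[ v′ ] (v , c , v′) ∈ δ

  record Edge : Set where
    constructor edge
    field
      src : V
      col : Σ
      tgt : V
      ∈δ  : (src , col , tgt) ∈ δ

  open Edge public

  -- V ∪ δ⁺, where (w , e) stands for the nonempty word we.
  History : Set
  History = V ⊎ (List Edge × Edge)

  current : History → V
  current (inj₁ v)       = v
  current (inj₂ (w , e)) = tgt e

  extend : History → Edge → History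
  extend (inj₁ v)       e′ = inj₂ ([] , e′)
  extend (inj₂ (w , e)) e′ = inj₂ (w ++ [ e ] , e′)

  record Strategy : Set where
    field
      move  : History → Edge
      legal : ∀ h → src (move h) ≡ current h

  record PositionalStrategy : Set where
    field
      move  : V → Edge
      legal : ∀ v → src (move v) ≡ v

  toStrategy : PositionalStrategy → Strategy
  toStrategy σ = record { move = move ∘ current ; legal = legal ∘ current }
    where open PositionalStrategy σ

  nextEdge : Strategy → Strategy → History → Edge
  nextEdge σ₁ σ₂ h with current h
  ... | inj₁ _ = Strategy.move σ₁ h
  ... | inj₂ _ = Strategy.move σ₂ h

  history : Strategy → Strategy → V → ℕ → History
  history σ₁ σ₂ q zero    = inj₁ q
  history σ₁ σ₂ q (suc i) =
    extend (history σ₁ σ₂ q i) (nextEdge σ₁ σ₂ (history σ₁ σ₂ q i))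

  play : Strategy → Strategy → V → ℕ → Edge
  play σ₁ σ₂ q i = nextEdge σ₁ σ₂ (history σ₁ σ₂ q i)

  trace : Strategy → Strategy → V → ωWord Σ
  trace σ₁ σ₂ q = col ∘ play σ₁ σ₂ q

  WinningFrom : ωLanguage Σ → Strategy → V → Set
  WinningFrom L σ₁ q = ∀ σ₂ → L (trace σ₁ σ₂ q)

Positional : {Σ : Set} → ωLanguage Σ → Set₁
Positional {Σ} L =
  (G : Arena Σ) → let open Arena G in
  (W : Subset V) (σ : Strategy) →
  (∀ q → q ∈ W → WinningFrom L σ q) →
  ∃ λ (τ : PositionalStrategy) → ∀ q → q ∈ W → WinningFrom L (toStrategy τ) q

------------------------------------------------------------------------
-- ω-star-free languages

dropLetter : {Σ : Set} → (ℕ → List⁺ Σ) → (ℕ → List⁺ Σ)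
dropLetter u i with u 0
dropLetter u i       | a ∷ []     = u (suc i)
dropLetter u zero    | a ∷ b ∷ bs = b ∷ bs
dropLetter u (suc i) | a ∷ b ∷ bs = u (suc i)

-- The infinite concatenation u 0 · u 1 · u 2 ⋯
flatten : {Σ : Set} → (ℕ → List⁺ Σ) → ωWord Σ
flatten u zero    = head (u 0)
flatten u (suc n) = flatten (dropLetter u) n

-- Finiteness and aperiodicity are both relative to the monoid's own equality ≈.
Aperiodic : Monoid 0ℓ 0ℓ → Set
Aperiodic M = ∀ x → ∃[ n ] n ^ x ≈ suc n ^ x
  where
  open Monoid M
  -- n ^ x is the n-th power of x.
  open RawMonoidDefinitions rawMonoid using () renaming (_×_ to _^_)

record RecognisedBy {Σ : Set} (L : ωLanguage Σ) (M : Monoid 0ℓ 0ℓ) : Set where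
  open Monoid M
  open MonoidMorphisms (++-[]-rawMonoid Σ) rawMonoid using (IsMonoidHomomorphism)
  field
    h              : List Σ → Carrier
    isHomomorphism : IsMonoidHomomorphism h
    -- ≗ because functions ℕ → Σ are compared pointwise.
    saturates      : ∀ {w w′} (u u′ : ℕ → List⁺ Σ) →
                     w ≗ flatten u → w′ ≗ flatten u′ →
                     (∀ i → h (toList (u i)) ≈ h (toList (u′ i))) →
                     L w ⇔ L w′

ωStarFree : {Σ : Set} → ωLanguage Σ → Set₁
ωStarFree L =
  ∃ λ (M : Monoid 0ℓ 0ℓ) →
    FiniteSetoid (Monoid.setoid M) × Aperiodic M × RecognisedBy L M

{-# OPTIONS --safe #-}

-- Two words are equivalent when L does not distinguish them in the contexts
-- c _ b z^ω and c (_ b)^ω.  The path profiles of a Büchi automaton for L bound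
-- the number of classes, and Ramsey's theorem shows that the quotient monoid
-- recognises L.  For aperiodicity let the powers of u have profiles of period p
-- from some exponent on, and suppose that u^s is accepted in a context.  In the
-- arena in which Player 2 reads some u^i and Player 1 answers with some u^j b,
-- Player 1 wins by choosing j such that i + j ≡ s (mod p).  A positional
-- strategy always answers with the same j, so every residue mod p is accepted:
-- in a given context, large powers of u are all accepted or all rejected.

module Submission where

open import Algebra.Bundles using (Monoid)
import Algebra.Definitions.RawMonoid as RawMonoidDefinitions
open import Axiom.ExcludedMiddle using (ExcludedMiddle)
open import Data.Bool.Base using (Bool; true; false; _∨_)
open import Data.Empty using (⊥)
open import Data.Fin.Base
  using (Fin; zero; suc; toℕ; combine; funToFin; finToFun; opposite; fromℕ<)
open import Data.Fin.Properties
  using (pigeonhole; toℕ≤pred[n]; toℕ<n; toℕ-injective; toℕ-fromℕ<; opposite-prop;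
         finToFun-funToFin; combine-injective; *↔×; 1↔⊤; 2↔Bool)
open import Data.List.Base using (List; []; _∷_; _++_; length; lookup; tabulate; concatMap)
open import Data.List.Membership.Propositional using (lose; find) renaming (_∈_ to _∈ˡ_)
open import Data.List.Membership.Propositional.Properties
  using (∈-concatMap⁺; ∈-concatMap⁻; ∈-++⁺ˡ; ∈-++⁺ʳ; ∈-tabulate⁺; ∈-lookup)
open import Data.List.NonEmpty.Base using (List⁺; _∷_; head; tail; toList; _++⁺_; _⁺++_)
open import Data.List.NonEmpty.Properties using (++-++⁺)
open import Data.List.Properties using (++-assoc; ++-identityʳ)
open import Data.List.Relation.Unary.Any using (here; there; index)
open import Data.List.Relation.Unary.Any.Properties using (lookup-index)
open import Data.Nat.Base
open import Data.Nat.Properties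
open import Data.Nat.Solver using (module +-*-Solver)
open import Data.Product.Base using (∃; ∃-syntax; _×_; _,_; proj₁; proj₂)
open import Data.Product.Function.NonDependent.Propositional using (_×-↔_)
open import Data.Sum.Base using (_⊎_; inj₁; inj₂)
open import Data.Unit.Base using (⊤; tt)
open import Function.Base using (_∘_; id; case_of_)
open import Function.Bundles using (Inverse; _⇔_; Equivalence; mk⇔)
open import Function.Construct.Composition using (_↔-∘_)
open import Function.Construct.Identity using (↔-id)
open import Function.Construct.Symmetry using (↔-sym)
open import Level using (0ℓ)
open import Relation.Binary.Bundles using (Setoid)
open import Relation.Binary.PropositionalEquality
open import Relation.Nullary using (¬_; contradiction; Dec; yes; no)
open import Relation.Nullary.Decidable using (decidable-stable; isYes; toWitness; fromWitness)
open import Defs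

open +-*-Solver using (solve; con; _:+_; _:=_)

-- The profiles alone already give a finite monoid recognising `L`, but it depends on the automaton,
-- which may count modulo some number to no effect, so it need not be aperiodic. A game sees nothing
-- but membership in `L`; hence the passage to a congruence defined by `L` itself. Its compatibility
-- with infinite products is then no longer immediate, and Ramsey's theorem is needed to reduce it
-- to ultimately periodic words. All choices of Player 2 lead to one and the same vertex of Player
-- 1, so the winning strategy has to remember i. In the cyclic context the game is repeated forever
-- and its rounds may use different exponents; when Player 2 repeats one i against a positional
-- strategy, every round has the same exponent, so the play again fills the context with a single
-- power of u.

-- Infinite concatenation and ultimately periodic words

module _ {Σ : Set} where

  infixr 5 _++ω_

  _++ω_ : List Σ → ωWord Σ → ωWord Σ
  ([]      ++ω w) n       = w n
  ((x ∷ l) ++ω w) zero    = x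
  ((x ∷ l) ++ω w) (suc n) = (l ++ω w) n

  ++ω-cong-≤ : ∀ l {w w′ : ωWord Σ} n → (∀ m → m ≤ n → w m ≡ w′ m) →
               (l ++ω w) n ≡ (l ++ω w′) n
  ++ω-cong-≤ []      n       eq = eq n ≤-refl
  ++ω-cong-≤ (x ∷ l) zero    eq = refl
  ++ω-cong-≤ (x ∷ l) (suc n) eq = ++ω-cong-≤ l n λ m m≤n → eq m (m≤n⇒m≤1+n m≤n)

  ++ω-cong : ∀ l {w w′ : ωWord Σ} → w ≗ w′ → l ++ω w ≗ l ++ω w′
  ++ω-cong l eq n = ++ω-cong-≤ l n λ m _ → eq m

  ++ω-assoc : ∀ l m (w : ωWord Σ) → (l ++ m) ++ω w ≗ l ++ω m ++ω w
  ++ω-assoc []      m w n       = refl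
  ++ω-assoc (x ∷ l) m w zero    = refl
  ++ω-assoc (x ∷ l) m w (suc n) = ++ω-assoc l m w n

  dropLetter-cong : ∀ {u u′ : ℕ → List⁺ Σ} → u ≗ u′ → dropLetter u ≗ dropLetter u′
  dropLetter-cong {u} {u′} eq i with u 0 | u′ 0 | eq 0
  dropLetter-cong eq i       | a ∷ []     | _ | refl = eq (suc i)
  dropLetter-cong eq zero    | a ∷ b ∷ bs | _ | refl = refl
  dropLetter-cong eq (suc i) | a ∷ b ∷ bs | _ | refl = eq (suc i)

  flatten-cong : ∀ {u u′ : ℕ → List⁺ Σ} → u ≗ u′ → flatten u ≗ flatten u′
  flatten-cong eq zero    = cong head (eq 0)
  flatten-cong eq (suc n) = flatten-cong (dropLetter-cong eq) n

  dropLetter-[] : ∀ (u : ℕ → List⁺ Σ) {a} → u 0 ≡ a ∷ [] → dropLetter u ≗ u ∘ suc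
  dropLetter-[] u eq i with u 0
  dropLetter-[] u refl i | a ∷ [] = refl

  dropLetter-∷ : ∀ (u : ℕ → List⁺ Σ) {a b bs} → u 0 ≡ a ∷ b ∷ bs →
                 dropLetter u 0 ≡ b ∷ bs × dropLetter u ∘ suc ≗ u ∘ suc
  dropLetter-∷ u eq with u 0
  dropLetter-∷ u refl | a ∷ b ∷ bs = refl , λ i → refl

  flatten-step : ∀ (u : ℕ → List⁺ Σ) → flatten u ≗ toList (u 0) ++ω flatten (u ∘ suc)
  flatten-step u zero    = refl
  flatten-step u (suc n) = go (u 0) refl
    where
    go : ∀ v → u 0 ≡ v → flatten (dropLetter u) n ≡ (tail (u 0) ++ω flatten (u ∘ suc)) n
    go (a ∷ [])     eq = trans (flatten-cong (dropLetter-[] u eq) n)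
      (cong (λ v → (tail v ++ω flatten (u ∘ suc)) n) (sym eq))
    go (a ∷ b ∷ bs) eq = trans (flatten-step (dropLetter u) n)
      (trans (cong (λ v → (toList v ++ω flatten (dropLetter u ∘ suc)) n) (proj₁ (dropLetter-∷ u eq)))
      (trans (++ω-cong (b ∷ bs) (flatten-cong (proj₂ (dropLetter-∷ u eq))) n)
      (cong (λ v → (tail v ++ω flatten (u ∘ suc)) n) (sym eq))))

  -- Blocks are nonempty, so the equation for `W i` yields its first letter outright and refers to
  -- `W (suc i)` only at smaller positions. Induction on a bound `k` for the position therefore
  -- replaces coinduction.
  flatten-unique : ∀ (u : ℕ → List⁺ Σ) (W : ℕ → ωWord Σ) →
                   (∀ i → W i ≗ toList (u i) ++ω W (suc i)) → W 0 ≗ flatten u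
  flatten-unique u W eq n = go (suc n) u W eq n ≤-refl
    where
    go : ∀ k (u : ℕ → List⁺ Σ) (W : ℕ → ωWord Σ) → (∀ i → W i ≗ toList (u i) ++ω W (suc i)) →
         ∀ n → n < k → W 0 n ≡ flatten u n
    go (suc k) u W eq zero    _         = eq 0 0
    go (suc k) u W eq (suc n) (s≤s n<k) = trans (eq 0 (suc n)) (trans
      (++ω-cong-≤ (tail (u 0)) n λ m m≤n → go k (u ∘ suc) (W ∘ suc) (eq ∘ suc) m (≤-<-trans m≤n n<k))
      (sym (flatten-step u (suc n))))

  lasso : List⁺ Σ → List⁺ Σ → ℕ → List⁺ Σ
  lasso s z zero    = s
  lasso s z (suc i) = z

  repeatω : List⁺ Σ → ωWord Σ
  repeatω z = flatten λ _ → z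

  flatten-lasso : ∀ s z → flatten (lasso s z) ≗ toList s ++ω repeatω z
  flatten-lasso s z = flatten-step (lasso s z)

  repeatω-step : ∀ z → repeatω z ≗ toList z ++ω repeatω z
  repeatω-step z = flatten-step λ _ → z

  -- The word x(yx)^ω solves W = xyW, whose only solution is (xy)^ω.
  repeatω-rotate : ∀ {z z′} x y → toList z ≡ x ++ y → toList z′ ≡ y ++ x →
                   repeatω z ≗ x ++ω repeatω z′
  repeatω-rotate {z} {z′} x y eq eq′ n = sym (flatten-unique (λ _ → z) (λ _ → W) (λ _ → W-step) n)
    where
    W : ωWord Σ
    W = x ++ω repeatω z′

    W-step : W ≗ toList z ++ω W
    W-step n = begin
      (x ++ω repeatω z′) n                 ≡⟨ ++ω-cong x (repeatω-step z′) n ⟩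
      (x ++ω toList z′ ++ω repeatω z′) n   ≡⟨ cong (λ l → (x ++ω l ++ω repeatω z′) n) eq′ ⟩
      (x ++ω (y ++ x) ++ω repeatω z′) n    ≡⟨ ++ω-cong x (++ω-assoc y x _) n ⟩
      (x ++ω y ++ω W) n                    ≡⟨ ++ω-assoc x y W n ⟨
      ((x ++ y) ++ω W) n                   ≡⟨ cong (λ l → (l ++ω W) n) eq ⟨
      (toList z ++ω W) n                   ∎
      where open ≡-Reasoning

  toList-++⁺ : ∀ l (m : List⁺ Σ) → toList (l ++⁺ m) ≡ l ++ toList m
  toList-++⁺ []      m = refl
  toList-++⁺ (x ∷ l) m = cong (x ∷_) (toList-++⁺ l m)

  -- The leading copy, together with a z read before, makes up the first turn of the loop, which
  -- cyclic contexts spell out.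
  repeatω-double : ∀ z → repeatω z ≗ toList z ++ω repeatω (toList z ++⁺ z)
  repeatω-double z n = trans (repeatω-step z n)
    (++ω-cong (toList z) (flatten-unique (λ _ → toList z ++⁺ z) (λ _ → repeatω z) (λ _ → step)) n)
    where
    step : repeatω z ≗ toList (toList z ++⁺ z) ++ω repeatω z
    step n = begin
      repeatω z n                                  ≡⟨ repeatω-step z n ⟩
      (toList z ++ω repeatω z) n                   ≡⟨ ++ω-cong (toList z) (repeatω-step z) n ⟩
      (toList z ++ω toList z ++ω repeatω z) n      ≡⟨ ++ω-assoc (toList z) (toList z) (repeatω z) n ⟨
      ((toList z ++ toList z) ++ω repeatω z) n     ≡⟨ cong (λ l → (l ++ω repeatω z) n) (toList-++⁺ (toList z) z) ⟨
      (toList (toList z ++⁺ z) ++ω repeatω z) n    ∎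
      where open ≡-Reasoning

-- Streams produced by a deterministic system with output

module Unfold {S Σ : Set} (out : S → Σ) (next : S → S) where

  iter : S → ℕ → S
  iter s zero    = s
  iter s (suc n) = next (iter s n)

  iter-next : ∀ s n → iter (next s) n ≡ iter s (suc n)
  iter-next s zero    = refl
  iter-next s (suc n) = cong next (iter-next s n)

  iter-+ : ∀ s m n → iter (iter s m) n ≡ iter s (n + m)
  iter-+ s m zero    = refl
  iter-+ s m (suc n) = cong next (iter-+ s m n)

  stream : S → ωWord Σ
  stream s n = out (iter s n)

  data Reads : S → List Σ → S → Set where
    []  : ∀ {s} → Reads s [] s
    _∷_ : ∀ {s x l s′} → out s ≡ x → Reads (next s) l s′ → Reads s (x ∷ l) s′

  Reads-++ : ∀ {s l s′ l′ s″} → Reads s l s′ → Reads s′ l′ s″ → Reads s (l ++ l′) s″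
  Reads-++ []       r′ = r′
  Reads-++ (eq ∷ r) r′ = eq ∷ Reads-++ r r′

  _⇝_ : S → S → Set
  s ⇝ s′ = ∃[ n ] iter s n ≡ s′

  ⇝-trans : ∀ {s s′ s″} → s ⇝ s′ → s′ ⇝ s″ → s ⇝ s″
  ⇝-trans {s} (m , refl) (n , refl) = n + m , sym (iter-+ s m n)

  Reads⇒⇝ : ∀ {s l s′} → Reads s l s′ → s ⇝ s′
  Reads⇒⇝ []          = 0 , refl
  Reads⇒⇝ {s} (_ ∷ r) = ⇝-trans (1 , refl) (Reads⇒⇝ r)

  Reads⇒stream : ∀ {s l s′} → Reads s l s′ → stream s ≗ l ++ω stream s′
  Reads⇒stream []               n       = refl
  Reads⇒stream (eq ∷ r)         zero    = eq
  Reads⇒stream {s} (eq ∷ r)     (suc n) = trans (cong out (sym (iter-next s n))) (Reads⇒stream r n)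

  Reads⇒flatten : ∀ (u : ℕ → List⁺ Σ) (s : ℕ → S) →
                  (∀ i → Reads (s i) (toList (u i)) (s (suc i))) → stream (s 0) ≗ flatten u
  Reads⇒flatten u s r = flatten-unique u (stream ∘ s) (λ i → Reads⇒stream (r i))

-- Classical combinatorics: finite quotients, pigeonhole, Ramsey's theorem

Infinitely : (ℕ → Set) → Set
Infinitely P = ∀ n → ∃[ j ] (n ≤ j × P j)

upper-bound : ∀ {N} (b : Fin N → ℕ) → ∃[ m ] ∀ e → b e ≤ m
upper-bound {zero}  b = 0 , λ ()
upper-bound {suc N} b with m , b≤m ← upper-bound (b ∘ suc) =
  b zero ⊔ m , λ { zero → m≤m⊔n _ _ ; (suc e) → ≤-trans (b≤m e) (m≤n⊔m (b zero) m) }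

module Classical (em : ExcludedMiddle 0ℓ) where

  ¬Infinitely⇒eventually-¬ : ∀ {P} → ¬ Infinitely P → ∃[ n ] ∀ j → n ≤ j → ¬ P j
  ¬Infinitely⇒eventually-¬ ¬inf = decidable-stable em λ ¬ev →
    ¬inf λ n → decidable-stable em λ ¬ex → ¬ev (n , λ j n≤j Pj → ¬ex (j , n≤j , Pj))

  infinite-pigeonhole : ∀ {P N} → Infinitely P → (f : ℕ → Fin N) →
                        ∃[ e ] Infinitely (λ j → P j × f j ≡ e)
  infinite-pigeonhole {P} inf f = decidable-stable em λ ¬ex →
    let none = λ e → ¬Infinitely⇒eventually-¬ λ inf′ → ¬ex (e , inf′)
        m , n≤m = upper-bound (proj₁ ∘ none)
        j , m≤j , Pj = inf m
    in proj₂ (none (f j)) j (≤-trans (n≤m (f j)) m≤j) (Pj , refl)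

  module _ (S : Setoid 0ℓ 0ℓ) where

    private module S = Setoid S

    -- The code may be finer than the equality, so code values cannot simply be counted. They are
    -- processed in order, and a representative is added only if some element with code `k` is equal
    -- to no earlier one; it then serves all elements with that code.
    finite-setoid : ∀ {N} (code : S.Carrier → Fin N) →
                    (∀ {x y} → code x ≡ code y → x S.≈ y) → FiniteSetoid S
    finite-setoid {N} code code-≈ with reps N
      where
      reps : ∀ k → ∃[ n ] ∃ λ (rep : Fin n → S.Carrier) →
             (∀ {i j} → rep i S.≈ rep j → i ≡ j) × (∀ x → toℕ (code x) < k → ∃[ i ] x S.≈ rep i)
      reps zero = 0 , (λ ()) , (λ { {()} }) , λ _ ()
      reps (suc k) with n , rep , inj , cover ← reps k
                   with em {∃[ x ] (toℕ (code x) ≡ k × ¬ (∃[ i ] x S.≈ rep i))}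
      ... | no  ¬new = n , rep , inj , λ x x<1+k → decidable-stable em λ ¬i →
        case m<1+n⇒m<n∨m≡n x<1+k of λ
          { (inj₁ x<k) → ¬i (cover x x<k)
          ; (inj₂ x≡k) → ¬new (x , x≡k , ¬i) }
      ... | yes (x₀ , x₀≡k , new) = suc n , rep′ , inj′ , cover′
        where
        rep′ : Fin (suc n) → S.Carrier
        rep′ zero    = x₀
        rep′ (suc i) = rep i

        inj′ : ∀ {i j} → rep′ i S.≈ rep′ j → i ≡ j
        inj′ {zero}  {zero}  _  = refl
        inj′ {zero}  {suc j} eq = contradiction (j , eq) new
        inj′ {suc i} {zero}  eq = contradiction (i , S.sym eq) new
        inj′ {suc i} {suc j} eq = cong suc (inj eq)

        cover′ : ∀ x → toℕ (code x) < suc k → ∃[ i ] x S.≈ rep′ i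
        cover′ x x<1+k with m<1+n⇒m<n∨m≡n x<1+k
        ... | inj₁ x<k = let i , eq = cover x x<k in suc i , eq
        ... | inj₂ x≡k = zero , code-≈ (toℕ-injective (trans x≡k (sym x₀≡k)))
    ... | n , rep , inj , cover = n , record
      { to        = class
      ; from      = rep
      ; to-cong   = λ {x} {y} x≈y → inj (S.trans (S.sym (rep-class x)) (S.trans x≈y (rep-class y)))
      ; from-cong = λ { refl → S.refl }
      ; inverse   = (λ {i} {x} x≈i → inj (S.trans (S.sym (rep-class x)) x≈i))
                  , (λ {x} {i} i≡x → S.trans (S.reflexive (cong rep i≡x)) (S.sym (rep-class x)))
      }
      where
      class : S.Carrier → Fin n
      class x = proj₁ (cover x (toℕ<n (code x)))

      rep-class : ∀ x → x S.≈ rep (class x)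
      rep-class x = proj₂ (cover x (toℕ<n (code x)))

  module _ {A X : Set} (A-finite : Finite A) (P : A → X → Set) where

    open Inverse (proj₂ A-finite)

    truth : ∀ {B : Set} → Dec B → Fin 2
    truth (yes _) = suc zero
    truth (no  _) = zero

    truth-cong : ∀ {B C : Set} (b : Dec B) (c : Dec C) → B ⇔ C → truth b ≡ truth c
    truth-cong (yes _) (yes _) _   = refl
    truth-cong (no _)  (no _)  _   = refl
    truth-cong (yes b) (no ¬c) B⇔C = contradiction (Equivalence.to B⇔C b) ¬c
    truth-cong (no ¬b) (yes c) B⇔C = contradiction (Equivalence.from B⇔C c) ¬b

    truth-reflects : ∀ {B C : Set} (b : Dec B) (c : Dec C) → truth b ≡ truth c → B → C
    truth-reflects (yes _) (yes c) _ _ = c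
    truth-reflects (no ¬b) _       _ b = contradiction b ¬b

    funToFin-cong : ∀ {m n} {f g : Fin m → Fin n} → f ≗ g → funToFin f ≡ funToFin g
    funToFin-cong {zero}  eq = refl
    funToFin-cong {suc m} eq = cong₂ combine (eq zero) (funToFin-cong (eq ∘ suc))

    -- The set of all `a` with `P a x` as a characteristic vector packed into one number. For path
    -- profiles it serves both as a bound on the number of classes and as the colouring for Ramsey's
    -- theorem.
    type : X → Fin (2 ^ proj₁ A-finite)
    type x = funToFin λ k → truth (em {P (from k) x})

    type-cong : ∀ {x y} → (∀ a → P a x ⇔ P a y) → type x ≡ type y
    type-cong P⇔ = funToFin-cong λ k → truth-cong em em (P⇔ (from k))

    type-reflects : ∀ {x y} → type x ≡ type y → ∀ a → P a x → P a y
    type-reflects {x} {y} eq a Pax = subst (λ b → P b y) (strictlyInverseʳ a)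
      (truth-reflects em em (trans (sym (finToFun-funToFin _ (to a))) (trans
        (cong (λ f → finToFun f (to a)) eq) (finToFun-funToFin _ (to a))))
        (subst (λ b → P b x) (sym (strictlyInverseʳ a)) Pax))

  -- Two starting points merge when their segments up to a common end point
  -- get the same colour, a property that persists for all later end points.
  module Ramsey {N} (C : ℕ → ℕ → Fin N)
    (extend : ∀ {i j m} → i ≤ m → j ≤ m → C i m ≡ C j m → C i (suc m) ≡ C j (suc m)) where

    Merge : ℕ → ℕ → Set
    Merge i j = ∃[ m ] (i ≤ m × j ≤ m × C i m ≡ C j m)

    merged : ∀ {i j m n} → i ≤ m → j ≤ m → C i m ≡ C j m → m ≤′ n → C i n ≡ C j n
    merged i≤m j≤m eq ≤′-refl       = eq
    merged i≤m j≤m eq (≤′-step m≤n) = extend (≤-trans i≤m (≤′⇒≤ m≤n)) (≤-trans j≤m (≤′⇒≤ m≤n))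
                                             (merged i≤m j≤m eq m≤n)

    -- If all classes were finite, N + 1 pairwise unmerged points would have
    -- different colours up to the last of them.
    module _ (none : ∀ i → 1 ≤ i → ∃[ n ] ∀ j → n ≤ j → ¬ Merge j i) where

      point : ℕ → ∃[ i ] 1 ≤ i
      point zero    = 1 , ≤-refl
      point (suc k) = let i , 1≤i = point k in i ⊔ proj₁ (none i 1≤i) , ≤-trans 1≤i (m≤m⊔n _ _)

      point-mono : ∀ {k l} → k ≤′ l → proj₁ (point k) ≤ proj₁ (point l)
      point-mono ≤′-refl       = ≤-refl
      point-mono (≤′-step k≤l) = ≤-trans (point-mono k≤l) (m≤m⊔n _ _)

      ¬finite-classes : ⊥
      ¬finite-classes with pigeonhole (n<1+n N) (λ k → C (proj₁ (point (toℕ k))) (proj₁ (point N)))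
      ... | i , j , i<j , eq = let p , 1≤p = point (toℕ i) in
        proj₂ (none p 1≤p) (proj₁ (point (toℕ j)))
          (≤-trans (m≤n⊔m p _) (point-mono (≤⇒≤′ i<j)))
          (proj₁ (point N) , point-mono (≤⇒≤′ (toℕ≤pred[n] j)) , point-mono (≤⇒≤′ (toℕ≤pred[n] i)) , sym eq)

    infinite-class : ∃[ i ] (1 ≤ i × Infinitely (λ j → Merge j i))
    infinite-class = decidable-stable em λ ¬ex →
      ¬finite-classes λ i 1≤i → ¬Infinitely⇒eventually-¬ λ inf → ¬ex (i , 1≤i , inf)

    -- Inside an infinite class of `i`, infinitely many `j` have the same colour `e` seen from `i`.
    -- If the successor `j′` of `j` is chosen beyond the point where `j` and `i` merge, then
    -- `C j j′ ≡ C i j′ ≡ e`.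
    homogeneous : ∃[ e ] ∃ λ (k : ℕ → ℕ) →
                  1 ≤ k 0 × (∀ n → k n < k (suc n)) × (∀ n → C (k n) (k (suc n)) ≡ e)
    homogeneous = let
        i , 1≤i , class = infinite-class
        e , inf = infinite-pigeonhole class (C i)
        later : ∀ n → ∃[ j ] (n ≤ j × Merge j i × C i j ≡ e)
        later = inf
        first : ∃[ j ] (Merge j i × C i j ≡ e)
        -- Searching from 1 gives `1 ≤ k 0`, so that the group of blocks before `k 0` is nonempty.
        first = let j , _ , p = later 1 in j , p
        next : ∃[ j ] (Merge j i × C i j ≡ e) → ∃[ j ] (Merge j i × C i j ≡ e)
        next (j , (m , _) , _) = let j′ , _ , p = later (suc m) in j′ , p
        open Unfold proj₁ next
        k = stream first
        step : ∀ s → proj₁ s < proj₁ (next s) × C (proj₁ s) (proj₁ (next s)) ≡ e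
        step = λ { (j , (m , j≤m , i≤m , eq) , _) →
          let j′ , m<j′ , _ , eq′ = later (suc m) in
          ≤-trans (s≤s j≤m) m<j′ , trans (merged j≤m i≤m eq (≤⇒≤′ (<⇒≤ m<j′))) eq′ }
      in e , k , proj₁ (proj₂ (later 1)) , (λ n → proj₁ (step (iter first n))) , (λ n → proj₂ (step (iter first n)))

-- Path profiles of a Büchi automaton

module Büchi {Σ : Set} (A : BüchiAutomaton Σ) where

  open BüchiAutomaton A

  -- A path marked true leaves an accepting state; one marked false may or may not.
  data Reach : Bool → Q → List Σ → Q → Set where
    []  : ∀ {q} → Reach false q [] q
    _∷_ : ∀ {b q a r l q′} → (q , a , r) ∈ Δ → Reach b r l q′ → Reach b q (a ∷ l) q′
    acc : ∀ {b q a r l q′} → q ∈ accepting → (q , a , r) ∈ Δ → Reach b r l q′ → Reach true q (a ∷ l) q′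

  Reach-++ : ∀ {b b′ q l r l′ q′} → Reach b q l r → Reach b′ r l′ q′ → Reach (b ∨ b′) q (l ++ l′) q′
  Reach-++ []          p′ = p′
  Reach-++ (d ∷ p)     p′ = d ∷ Reach-++ p p′
  Reach-++ (acc a d p) p′ = acc a d (Reach-++ p p′)

  Reach-split : ∀ l {b q l′ q′} → Reach b q (l ++ l′) q′ →
                ∃[ r ] ∃[ c ] ∃[ c′ ] (Reach c q l r × Reach c′ r l′ q′ × c ∨ c′ ≡ b)
  Reach-split []      p           = _ , false , _ , [] , p , refl
  Reach-split (x ∷ l) (d ∷ p)     = let r , c , c′ , p₁ , p₂ , eq = Reach-split l p in
                                    r , c , c′ , d ∷ p₁ , p₂ , eq
  Reach-split (x ∷ l) (acc a d p) = let r , c , c′ , p₁ , p₂ , eq = Reach-split l p in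
                                    r , true , c′ , acc a d p₁ , p₂ , refl

  Profile : Bool × Q × Q → List Σ → Set
  Profile (b , q , r) l = Reach b q l r

  Profile-finite : Finite (Bool × Q × Q)
  Profile-finite = let n , Q↔ = Q-finite in 2 * (n * n) ,
    ↔-sym *↔× ↔-∘ (↔-sym 2↔Bool ×-↔ (↔-sym *↔× ↔-∘ (Q↔ ×-↔ Q↔)))

  infix 4 _≼_ _∼_

  _≼_ : List Σ → List Σ → Set
  l ≼ m = ∀ x → Profile x l → Profile x m

  _∼_ : List Σ → List Σ → Set
  l ∼ m = l ≼ m × m ≼ l

  ++-mono : ∀ {l l′ m m′} → l ≼ l′ → m ≼ m′ → l ++ m ≼ l′ ++ m′
  ++-mono {l} l≼l′ m≼m′ (b , q , q′) p with Reach-split l p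
  ... | r , c , c′ , p₁ , p₂ , refl = Reach-++ (l≼l′ (c , q , r) p₁) (m≼m′ (c′ , r , q′) p₂)

  ++-cong : ∀ {l l′ m m′} → l ∼ l′ → m ∼ m′ → l ++ m ∼ l′ ++ m′
  ++-cong (l≼ , ≽l) (m≼ , ≽m) = ++-mono l≼ m≼ , ++-mono ≽l ≽m

  ∼-refl : ∀ {l} → l ∼ l
  ∼-refl = (λ _ p → p) , (λ _ p → p)

  ∼-reflexive : ∀ {l m} → l ≡ m → l ∼ m
  ∼-reflexive refl = ∼-refl

  ∼-sym : ∀ {l m} → l ∼ m → m ∼ l
  ∼-sym (f , g) = g , f

  ∼-trans : ∀ {l m n} → l ∼ m → m ∼ n → l ∼ n
  ∼-trans (f , g) (f′ , g′) = (λ x → f′ x ∘ f x) , (λ x → g x ∘ g′ x)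

  -- Acceptance expressed through the profiles of the blocks only, so that it carries over to blocks
  -- with larger profiles. The path promised by `recurrent` may differ from the one in `paths`; only
  -- the states at the block boundaries are shared.
  record BlockRun (u : ℕ → List⁺ Σ) : Set where
    field
      state     : ℕ → Q
      starts    : state 0 ∈ initial
      paths     : ∀ i → Reach false (state i) (toList (u i)) (state (suc i))
      recurrent : Infinitely λ j → Reach true (state j) (toList (u j)) (state (suc j))

  BlockRun-mono : ∀ {u u′} → (∀ i → toList (u i) ≼ toList (u′ i)) → BlockRun u → BlockRun u′
  BlockRun-mono u≼u′ B = record
    { state     = state
    ; starts    = starts
    ; paths     = λ i → u≼u′ i (_ , _ , _) (paths i)
    ; recurrent = λ i → let j , i≤j , p = recurrent i in j , i≤j , u≼u′ j (_ , _ , _) p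
    }
    where open BlockRun B

  IsRun : ωWord Σ → (ℕ → Q) → Set
  IsRun w r = ∀ i → (r i , w i , r (suc i)) ∈ Δ

  IsRun-cong : ∀ {w w′ r} → w ≗ w′ → IsRun w r → IsRun w′ r
  IsRun-cong {r = r} eq run i = subst (λ a → (r i , a , r (suc i)) ∈ Δ) (eq i) (run i)

  IsRun-drop : ∀ l {w r} → IsRun (l ++ω w) r → IsRun w (r ∘ (length l +_))
  IsRun-drop []      run i = run i
  IsRun-drop (x ∷ l) {r = r} run = IsRun-drop l {r = r ∘ suc} (run ∘ suc)

  IsRun-take : ∀ l {w r} → IsRun (l ++ω w) r → Reach false (r 0) l (r (length l + 0))
  IsRun-take []      run = []
  IsRun-take (x ∷ l) {r = r} run = run 0 ∷ IsRun-take l {r = r ∘ suc} (run ∘ suc)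

  IsRun-take-accepting : ∀ l {w r m} → IsRun (l ++ω w) r → m < length l → r m ∈ accepting →
                         Reach true (r 0) l (r (length l + 0))
  IsRun-take-accepting (x ∷ l) {r = r} {zero}  run _         a = acc a (run 0) (IsRun-take l {r = r ∘ suc} (run ∘ suc))
  IsRun-take-accepting (x ∷ l) {r = r} {suc m} run (s≤s m<l) a =
    run 0 ∷ IsRun-take-accepting l {r = r ∘ suc} (run ∘ suc) m<l a

  module _ {w u} (w≗u : w ≗ flatten u) (R : AcceptingRun w) where

    open AcceptingRun R

    private
      runs : ℕ → ℕ → Q
      runs zero    = run
      runs (suc i) = runs i ∘ (length (toList (u i)) +_)

      runs-IsRun : ∀ i → IsRun (toList (u i) ++ω flatten (λ j → u (suc j + i))) (runs i)
      runs-IsRun′ : ∀ i → IsRun (flatten (λ j → u (j + i))) (runs i)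
      runs-IsRun′ zero    = IsRun-cong (λ n → trans (w≗u n) (flatten-cong (λ j → cong u (sym (+-identityʳ j))) n)) steps
      runs-IsRun′ (suc i) = IsRun-cong (flatten-cong λ j → cong u (sym (+-suc j i)))
                              (IsRun-drop (toList (u i)) {r = runs i} (runs-IsRun i))
      runs-IsRun i = IsRun-cong (flatten-step λ j → u (j + i)) (runs-IsRun′ i)

      runs-recurrent : ∀ i → Infinitely λ j → runs i j ∈ accepting
      runs-recurrent zero    n = recurrent n
      runs-recurrent (suc i) n with runs-recurrent i (length (toList (u i)) + n)
      ... | m , l+n≤m , a with m≤n⇒∃[o]m+o≡n l+n≤m
      ... | k , refl = n + k , m≤m+n n k ,
        subst (λ j → runs i j ∈ accepting) (+-assoc (length (toList (u i))) n k) a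

      -- The bound `k` makes the recursion structural: if position `m` lies beyond block `i`,
      -- subtracting the length of that block, which is positive, gives a smaller position relative
      -- to block `suc i`.
      accepting-block : ∀ k i m → m < k → runs i m ∈ accepting →
        ∃[ j ] (i ≤ j × Reach true (runs j 0) (toList (u j)) (runs (suc j) 0))
      accepting-block (suc k) i m (s≤s m≤k) a with m <? length (toList (u i))
      ... | yes m<l = i , ≤-refl , IsRun-take-accepting (toList (u i)) {r = runs i} (runs-IsRun i) m<l a
      ... | no  m≮l with m≤n⇒∃[o]m+o≡n (≮⇒≥ m≮l)
      ... | m′ , refl with accepting-block k (suc i) m′ (≤-trans (s≤s (m≤n+m m′ _)) m≤k) a
      ... | j , i<j , p = j , <⇒≤ i<j , p

    accepted⇒BlockRun : BlockRun u
    accepted⇒BlockRun = record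
      { state     = λ i → runs i 0
      ; starts    = starts
      ; paths     = λ i → IsRun-take (toList (u i)) {r = runs i} (runs-IsRun i)
      ; recurrent = λ i → let m , _ , a = runs-recurrent i 0 in accepting-block (suc m) i m ≤-refl a
      }

  module _ (em : ExcludedMiddle 0ℓ) {u} (B : BlockRun u) where

    open BlockRun B

    private
      -- The index of a block with a path that reads the unread rest of it.
      Configuration : Set
      Configuration = ∃[ i ] ∃ λ (l : List⁺ Σ) → ∃[ q ] ∃[ b ] Reach b q (toList l) (state (suc i))

      -- A single run has to be assembled, so an accepting path must be taken wherever one exists;
      -- excluded middle decides this block by block.
      best : ∀ i → ∃[ b ] Reach b (state i) (toList (u i)) (state (suc i))
      best i with em {Reach true (state i) (toList (u i)) (state (suc i))}
      ... | yes p = true , p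
      ... | no  _ = false , paths i

      best-true : ∀ i → Reach true (state i) (toList (u i)) (state (suc i)) → proj₁ (best i) ≡ true
      best-true i p with em {Reach true (state i) (toList (u i)) (state (suc i))}
      ... | yes _ = refl
      ... | no ¬p = contradiction p ¬p

      start : ℕ → Configuration
      start i = i , u i , state i , best i

      letter : Configuration → Σ
      letter (_ , l , _) = head l

      current : Configuration → Q
      current (_ , _ , q , _) = q

      next : Configuration → Configuration
      next (i , a ∷ []    , _)                   = start (suc i)
      next (i , a ∷ b ∷ l , _ , _ , _ ∷ p)       = i , b ∷ l , _ , _ , p
      next (i , a ∷ b ∷ l , _ , _ , acc _ _ p)   = i , b ∷ l , _ , _ , p

      open Unfold letter next

      next-Δ : ∀ s → (current s , letter s , current (next s)) ∈ Δ
      next-Δ (i , a ∷ []    , _ , _ , d ∷ [])      = d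
      next-Δ (i , a ∷ []    , _ , _ , acc _ d [])  = d
      next-Δ (i , a ∷ b ∷ l , _ , _ , d ∷ _)       = d
      next-Δ (i , a ∷ b ∷ l , _ , _ , acc _ d _)   = d

      reads-block : ∀ i a l {q b} (p : Reach b q (a ∷ l) (state (suc i))) →
                    Reads (i , a ∷ l , q , b , p) (a ∷ l) (start (suc i))
      reads-block i a []      p           = refl ∷ []
      reads-block i a (b ∷ l) (d ∷ p)     = refl ∷ reads-block i b l p
      reads-block i a (b ∷ l) (acc _ d p) = refl ∷ reads-block i b l p

      start-⇝ : ∀ {i j} → i ≤′ j → start i ⇝ start j
      start-⇝ ≤′-refl           = 0 , refl
      start-⇝ (≤′-step {j} i≤j) = ⇝-trans (start-⇝ i≤j) (Reads⇒⇝ (reads-block j _ _ (proj₂ (best j))))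

      visits : ∀ i a l {q} (p : Reach true q (a ∷ l) (state (suc i))) →
               ∃[ s ] ((i , a ∷ l , q , true , p) ⇝ s × current s ∈ accepting)
      visits i a l       (acc q∈ _ _) = _ , (0 , refl) , q∈
      visits i a []      (_ ∷ ())
      visits i a (b ∷ l) (_ ∷ p)      = let s , r , a = visits i b l p in s , ⇝-trans (1 , refl) r , a

      start-visits : ∀ i → Reach true (state i) (toList (u i)) (state (suc i)) →
                     ∃[ s ] (start i ⇝ s × current s ∈ accepting)
      start-visits i p with best i | best-true i p
      ... | _ , p′ | refl = visits i _ _ p′

      -- The rest of the current block is read first, since `recurrent` promises accepting paths for
      -- whole blocks only.
      eventually : ∀ s → ∃[ s′ ] (s ⇝ s′ × current s′ ∈ accepting)
      eventually (i , l , q , b , p) =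
        let j , i<j , p′  = recurrent (suc i)
            s′ , r , a    = start-visits j p′
        in s′ , ⇝-trans (Reads⇒⇝ (reads-block i _ _ p)) (⇝-trans (start-⇝ (≤⇒≤′ i<j)) r) , a

    BlockRun⇒accepted : ∀ {w} → w ≗ flatten u → AcceptingRun w
    BlockRun⇒accepted {w} w≗u = record
      { run       = λ n → current (iter (start 0) n)
      ; starts    = starts
      ; steps     = IsRun-cong (λ n → trans (reads n) (sym (w≗u n))) λ n → next-Δ (iter (start 0) n)
      ; recurrent = λ i → case eventually (iter (start 0) i) of λ
          { (_ , (n , refl) , a) → n + i , m≤n+m i n ,
            subst (λ s → current s ∈ accepting) (iter-+ (start 0) i n) a }
      }
      where
      reads : stream (start 0) ≗ flatten u
      reads = Reads⇒flatten u start λ i → reads-block i _ _ (proj₂ (best i))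

-- The arena, its plays, and the effect of positionality

data Mode : Set where
  linear cyclic : Mode

-- Player 2 picks i at A and the word a ∷ X i is read on the way to B; there
-- Player 1 picks j and a ∷ Y j is read on the way back to A (cyclic) or to C,
-- where z is repeated forever (linear).  A finite list of words leads to a
-- finite list of configurations, which serve as the states of Player 2.
module Game (em : ExcludedMiddle 0ℓ) {Σ : Set} (mode : Mode) (a : Σ) (c : List Σ) {m n : ℕ}
            (X : Fin (suc m) → List⁺ Σ) (Y : Fin (suc n) → List⁺ Σ) (z : List⁺ Σ) where

  data Node : Set where
    A C : Node
    B   : Fin (suc m) → Node

  data Configuration : Set where
    atA atB : Configuration
    word    : Σ → List Σ → Node → Configuration

  -- While its word is being read, `B i` records Player 2's choice, and `node` forgets it on
  -- arrival. All choices thus meet in one configuration, where only the history tells them apart.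
  node : Node → Configuration
  node A     = atA
  node (B _) = atB
  node C     = word (head z) (tail z) C

  enter : List Σ → Node → Configuration
  enter []      d = node d
  enter (x ∷ l) d = word x l d

  exit-of : Mode → Node
  exit-of linear = C
  exit-of cyclic = A

  exit : Node
  exit = exit-of mode

  data _⟶[_]_ : Configuration → Σ → Configuration → Set where
    chooseX : ∀ i → atA ⟶[ a ] enter (toList (X i)) (B i)
    chooseY : ∀ j → atB ⟶[ a ] enter (toList (Y j)) exit
    read    : ∀ {x l d} → word x l d ⟶[ x ] enter l d

  suffixes : List Σ × Node → List Configuration
  suffixes ([]    , d) = []
  suffixes (x ∷ l , d) = word x l d ∷ suffixes (l , d)

  X-word : Fin (suc m) → List Σ × Node
  X-word i = toList (X i) , B i

  Y-word : Fin (suc n) → List Σ × Node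
  Y-word j = toList (Y j) , exit

  words : List (List Σ × Node)
  words = (c , A) ∷ (toList z , C) ∷ tabulate X-word ++ tabulate Y-word

  states : List Configuration
  states = atA ∷ concatMap suffixes words

  Valid : Configuration → Set
  Valid s = s ≡ atB ⊎ s ∈ˡ states

  words⇒states : ∀ {s wd} → wd ∈ˡ words → s ∈ˡ suffixes wd → s ∈ˡ states
  words⇒states wd∈ s∈ = there (∈-concatMap⁺ suffixes (lose wd∈ s∈))

  valid-node : ∀ d → Valid (node d)
  valid-node A     = inj₂ (here refl)
  valid-node (B i) = inj₁ refl
  valid-node C     = inj₂ (words⇒states (there (here refl)) (here refl))

  valid-enter : ∀ l d → (l , d) ∈ˡ words → Valid (enter l d)
  valid-enter []      d _   = valid-node d
  valid-enter (x ∷ l) d wd∈ = inj₂ (words⇒states wd∈ (here refl))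

  valid-X : ∀ i → Valid (enter (toList (X i)) (B i))
  valid-X i = valid-enter (toList (X i)) (B i) (there (there (∈-++⁺ˡ (∈-tabulate⁺ {f = X-word} i))))

  valid-Y : ∀ j → Valid (enter (toList (Y j)) exit)
  valid-Y j = valid-enter (toList (Y j)) exit (there (there (∈-++⁺ʳ (tabulate X-word) (∈-tabulate⁺ {f = Y-word} j))))

  suffixes-closed : ∀ wd {x l d} → word x l d ∈ˡ suffixes wd →
                    enter l d ≡ node d ⊎ enter l d ∈ˡ suffixes wd
  suffixes-closed (x ∷ []    , d) (here refl) = inj₁ refl
  suffixes-closed (x ∷ y ∷ l , d) (here refl) = inj₂ (there (here refl))
  suffixes-closed (x ∷ l     , d) (there s∈)  with suffixes-closed (l , d) s∈
  ... | inj₁ eq  = inj₁ eq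
  ... | inj₂ s′∈ = inj₂ (there s′∈)

  successor : ∀ s → Valid s → ∃[ x ] ∃[ t ] (s ⟶[ x ] t × Valid t)
  successor atA          _           = _ , _ , chooseX zero , valid-X zero
  successor atB          _           = _ , _ , chooseY zero , valid-Y zero
  successor (word x l d) (inj₂ (there s∈)) = _ , _ , read , valid
    where
    valid : Valid (enter l d)
    valid with wd , wd∈ , s∈wd ← find (∈-concatMap⁻ suffixes {xs = words} s∈) with suffixes-closed wd s∈wd
    ... | inj₁ eq  = subst Valid (sym eq) (valid-node d)
    ... | inj₂ s′∈ = inj₂ (words⇒states wd∈ s′∈)

  -- Vertices of Player 2 are positions in `states`, which may list the same `word` more than once.
  -- Since edges are defined through `config`, such copies behave alike, and plays are described by
  -- configurations instead of vertices.
  config : ⊤ ⊎ Fin (length states) → Configuration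
  config (inj₁ _) = atB
  config (inj₂ k) = lookup states k

  config-valid : ∀ v → Valid (config v)
  config-valid (inj₁ _) = inj₁ refl
  config-valid (inj₂ k) = inj₂ (∈-lookup k)

  vertex : ∀ {s} → Valid s → ∃[ v ] config v ≡ s
  vertex (inj₁ eq) = inj₁ tt , sym eq
  vertex (inj₂ s∈) = inj₂ (index s∈) , sym (lookup-index s∈)

  δ? : Subset ((⊤ ⊎ Fin (length states)) × Σ × (⊤ ⊎ Fin (length states)))
  δ? (v , x , v′) = isYes (em {config v ⟶[ x ] config v′})

  move-to : ∀ v {x t} → config v ⟶[ x ] t → Valid t → ∃[ v′ ] ((v , x , v′) ∈ δ? × config v′ ≡ t)
  move-to v st ok with v′ , refl ← vertex ok = v′ , fromWitness st , refl

  -- Player 1 owns the vertex B alone, so a positional strategy amounts to one edge.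
  arena : Arena Σ
  arena = record
    { V₁        = ⊤
    ; V₂        = Fin (length states)
    ; V₁-finite = 1 , ↔-sym 1↔⊤
    ; V₂-finite = _ , ↔-id _
    ; δ         = δ?
    ; total     = λ v → let x , t , st , ok = successor (config v) (config-valid v)
                            v′ , ∈δ , _     = move-to v st ok
                        in x , v′ , ∈δ
    }

  open Arena arena
    using (V; Edge; edge; src; col; tgt; ∈δ; History; current; extend; Strategy;
           PositionalStrategy; toStrategy; nextEdge; history; trace)

  default : V → Edge
  default v = let x , v′ , ∈δ = Arena.total arena v in edge v x v′ ∈δ

  edge-step : ∀ e → config (src e) ⟶[ col e ] config (tgt e)
  edge-step e = toWitness (∈δ e)

  edge-to : ∀ v {x t} → config v ⟶[ x ] t → Valid t → Edge
  edge-to v {x} st ok = let v′ , ∈δ , _ = move-to v st ok in edge v x v′ ∈δ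

  edge-to-tgt : ∀ v {x t} (st : config v ⟶[ x ] t) ok → config (tgt (edge-to v st ok)) ≡ t
  edge-to-tgt v st ok = proj₂ (proj₂ (move-to v st ok))

  initial-vertex : ∃[ q ] config q ≡ enter c A
  initial-vertex = vertex (valid-enter c A (here refl))

  round : Fin (suc m) → Fin (suc n) → List⁺ Σ
  round i j = a ∷ (toList (X i) ++ a ∷ toList (Y j))

  IsRound : (Fin (suc m) → Fin (suc n) → Set) → List⁺ Σ → Set
  IsRound G b = ∃[ i ] ∃[ j ] (G i j × b ≡ round i j)

  IsLater-of : Mode → (Fin (suc m) → Fin (suc n) → Set) → List⁺ Σ → Set
  IsLater-of linear G b = b ≡ z
  IsLater-of cyclic G b = IsRound G b

  IsLater : (Fin (suc m) → Fin (suc n) → Set) → List⁺ Σ → Set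
  IsLater = IsLater-of mode

  -- `G` bounds the pairs of choices that may occur in a round. It is used with `j ≡ ρ i` for the
  -- strategy with memory, and with one fixed pair for a positional strategy against a constant
  -- choice.
  record Outcome (G : Fin (suc m) → Fin (suc n) → Set) (w : ωWord Σ) : Set where
    field
      blocks : ℕ → List⁺ Σ
      first  : IsRound G (blocks 0)
      later  : ∀ k → IsLater G (blocks (suc k))
      word≗  : w ≗ c ++ω flatten blocks

  -- The configuration from which the last edge of a history departed; at B it
  -- still shows Player 2's last choice.
  departed : History → Configuration
  departed (inj₁ _)       = atA
  departed (inj₂ (_ , e)) = config (src e)

  module Play (σ₁ σ₂ : Strategy) where

    edge-after : History → Edge
    edge-after = nextEdge σ₁ σ₂

    next : History → History
    next h = extend h (edge-after h)

    open Unfold (col ∘ edge-after) next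

    trace≗stream : ∀ q → trace σ₁ σ₂ q ≗ stream (inj₁ q)
    trace≗stream q i = cong (col ∘ edge-after) (go i)
      where
      go : ∀ i → history σ₁ σ₂ q i ≡ iter (inj₁ q) i
      go zero    = refl
      go (suc i) = cong next (go i)

    src-after : ∀ h → src (edge-after h) ≡ current h
    src-after h with current h in eq
    ... | inj₁ _ = trans (Strategy.legal σ₁ h) eq
    ... | inj₂ _ = trans (Strategy.legal σ₂ h) eq

    current-extend : ∀ h e → current (extend h e) ≡ tgt e
    current-extend (inj₁ _) e = refl
    current-extend (inj₂ _) e = refl

    departed-extend : ∀ h e → departed (extend h e) ≡ config (src e)
    departed-extend (inj₁ _) e = refl
    departed-extend (inj₂ _) e = refl

    departed-next : ∀ h → departed (next h) ≡ config (current h)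
    departed-next h = trans (departed-extend h _) (cong config (src-after h))

    step : ∀ h {s} → config (current h) ≡ s → s ⟶[ col (edge-after h) ] config (current (next h))
    step h refl = subst₂ (λ v v′ → config v ⟶[ col (edge-after h) ] config v′) (src-after h)
                    (sym (current-extend h (edge-after h))) (edge-step (edge-after h))

    word-step : ∀ {x l d y t} → word x l d ⟶[ y ] t → y ≡ x × t ≡ enter l d
    word-step read = refl , refl

    reads-word : ∀ {x} l {d} h → config (current h) ≡ word x l d →
                 ∃[ h′ ] (Reads h (x ∷ l) h′ × config (current h′) ≡ node d ×
                          ∃[ y ] departed h′ ≡ word y [] d)
    reads-word l h eq with st ← step h eq | word-step st
    reads-word []      h eq | y≡x , t≡ = next h , y≡x ∷ [] , t≡ , _ , trans (departed-next h) eq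
    reads-word (_ ∷ l) h eq | y≡x , t≡ = let h′ , r , rest = reads-word l (next h) t≡ in h′ , y≡x ∷ r , rest

    reads-enter : ∀ l {d} h → config (current h) ≡ enter l d →
                  ∃[ h′ ] (Reads h l h′ × config (current h′) ≡ node d)
    reads-enter []      h eq = h , [] , eq
    reads-enter (x ∷ l) h eq = let h′ , r , eq′ , _ = reads-word l h eq in h′ , r , eq′

    atA-letter : ∀ h → config (current h) ≡ atA → col (edge-after h) ≡ a
    atA-letter h eq = go (step h eq)
      where
      go : ∀ {y t} → atA ⟶[ y ] t → y ≡ a
      go (chooseX _) = refl

    atB-letter : ∀ h → config (current h) ≡ atB → col (edge-after h) ≡ a
    atB-letter h eq = go (step h eq)
      where
      go : ∀ {y t} → atB ⟶[ y ] t → y ≡ a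
      go (chooseY _) = refl

    module _ {P : Fin (suc m) → Set} {R : Fin (suc m) → Fin (suc n) → Set}
      (atA-choice : ∀ h → config (current h) ≡ atA →
                    ∃[ i ] (P i × config (current (next h)) ≡ enter (toList (X i)) (B i)))
      (atB-choice : ∀ h {y i} → config (current h) ≡ atB → departed h ≡ word y [] (B i) →
                    ∃[ j ] (R i j × config (current (next h)) ≡ enter (toList (Y j)) exit)) where

      private
        G : Fin (suc m) → Fin (suc n) → Set
        G i j = P i × R i j

      reads-round : ∀ h → config (current h) ≡ atA → ∃[ b ] ∃[ h′ ]
                    (IsRound G b × Reads h (toList b) h′ × config (current h′) ≡ node exit)
      reads-round h eq with atA-choice h eq
      ... | i , Pi , eqX with reads-word _ (next h) eqX
      ... | h₁ , r₁ , eq₁ , y , dep with atB-choice h₁ eq₁ dep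
      ... | j , Rij , eqY with reads-enter (toList (Y j)) (next h₁) eqY
      ... | h₂ , r₂ , eq₂ = round i j , h₂ , (i , j , (Pi , Rij) , refl) ,
        atA-letter h eq ∷ Reads-++ r₁ (atB-letter h₁ eq₁ ∷ r₂) , eq₂

      reads-later : ∀ h → config (current h) ≡ node exit → ∃[ b ] ∃[ h′ ]
                    (IsLater G b × Reads h (toList b) h′ × config (current h′) ≡ node exit)
      -- `mode` is fixed outside, so the case distinction is made on a copy with an equation, along
      -- which the results are transported.
      reads-later h eq = go mode refl
        where
        go : ∀ k → mode ≡ k → ∃[ b ] ∃[ h′ ]
             (IsLater G b × Reads h (toList b) h′ × config (current h′) ≡ node exit)
        go linear mode≡ =
          let exit≡        = cong (node ∘ exit-of) mode≡
              h′ , r , eq′ , _ = reads-word _ h (trans eq exit≡)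
          in z , h′ , subst (λ k → IsLater-of k G z) (sym mode≡) refl , r , trans eq′ (sym exit≡)
        go cyclic mode≡ =
          let b , h′ , isR , r , eq′ = reads-round h (trans eq (cong (node ∘ exit-of) mode≡))
          in b , h′ , subst (λ k → IsLater-of k G b) (sym mode≡) isR , r , eq′

      outcome : ∀ q → config q ≡ enter c A → Outcome G (trace σ₁ σ₂ q)
      outcome q eq
        with h₀ , r₀ , eq₀ ← reads-enter c (inj₁ q) eq
        with b₀ , h₁ , isR , r₁ , eq₁ ← reads-round h₀ eq₀ = record
        { blocks = blocks
        ; first  = isR
        ; later  = λ k → let h , eq = position k ; _ , _ , later , _ = reads-later h eq in later
        ; word≗  = λ n → trans (trace≗stream q n) (trans (Reads⇒stream r₀ n)
                          (++ω-cong c (Reads⇒flatten blocks histories reads) n))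
        }
        where
        position : ℕ → ∃[ h ] config (current h) ≡ node exit
        position zero    = h₁ , eq₁
        position (suc k) = let h , eq = position k ; _ , h′ , _ , _ , eq′ = reads-later h eq in h′ , eq′

        blocks : ℕ → List⁺ Σ
        blocks zero    = b₀
        blocks (suc k) = let h , eq = position k in proj₁ (reads-later h eq)

        histories : ℕ → History
        histories zero    = h₀
        histories (suc k) = proj₁ (position k)

        reads : ∀ k → Reads (histories k) (toList (blocks k)) (histories (suc k))
        reads zero    = r₁
        reads (suc k) = let h , eq = position k ; _ , _ , _ , r , _ = reads-later h eq in r

    nextEdge-₁ : ∀ h → current h ≡ inj₁ tt → edge-after h ≡ Strategy.move σ₁ h
    nextEdge-₁ h eq with current h | eq
    ... | _ | refl = refl

    nextEdge-₂ : ∀ h {k} → current h ≡ inj₂ k → edge-after h ≡ Strategy.move σ₂ h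
    nextEdge-₂ h eq with current h | eq
    ... | _ | refl = refl

  atA-player₂ : ∀ v → config v ≡ atA → ∃[ k ] v ≡ inj₂ k
  atA-player₂ (inj₂ k) _ = k , refl

  -- `atB` does not occur in `states`. At B it is therefore always Player 1 who moves, and always
  -- from the same vertex.
  atB-unique : ∀ v → config v ≡ atB → v ≡ inj₁ tt
  atB-unique (inj₁ tt) _  = refl
  atB-unique (inj₂ k)  eq = contradiction (subst (_∈ˡ states) eq (∈-lookup k)) atB∉
    where
    atB∉suffixes : ∀ l d → ¬ atB ∈ˡ suffixes (l , d)
    atB∉suffixes (x ∷ l) d (there p) = atB∉suffixes l d p

    atB∉ : ¬ atB ∈ˡ states
    atB∉ (there p) = let _ , _ , p′ = find (∈-concatMap⁻ suffixes {xs = words} p) in atB∉suffixes _ _ p′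

  module _ (ρ : Fin (suc m) → Fin (suc n)) where

    reply : Configuration → Fin (suc n)
    reply (word _ _ (B i)) = ρ i
    -- A default that the plays in question never reach: starting from `enter c A`, they arrive at B
    -- only from the last letter of some `X i`, which is nonempty.
    reply _                = zero

    respond : V → Configuration → Edge
    respond (inj₁ tt) s = edge-to (inj₁ tt) (chooseY (reply s)) (valid-Y (reply s))
    respond (inj₂ k)  _ = default (inj₂ k)

    respond-src : ∀ v s → src (respond v s) ≡ v
    respond-src (inj₁ _) s = refl
    respond-src (inj₂ _) s = refl

    responding : Strategy
    responding = record
      { move  = λ h → respond (current h) (departed h)
      ; legal = λ h → respond-src (current h) (departed h)
      }

    responding-outcome : ∀ σ₂ q → config q ≡ enter c A →
                         Outcome (λ i j → ⊤ × j ≡ ρ i) (trace responding σ₂ q)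
    responding-outcome σ₂ = outcome atA-choice atB-choice
      where
      open Play responding σ₂

      atA-choice : ∀ h → config (current h) ≡ atA →
                   ∃[ i ] (⊤ × config (current (next h)) ≡ enter (toList (X i)) (B i))
      atA-choice h eq = go (step h eq)
        where
        go : ∀ {y t} → atA ⟶[ y ] t → ∃[ i ] (⊤ × t ≡ enter (toList (X i)) (B i))
        go (chooseX i) = i , tt , refl

      atB-choice : ∀ h {y i} → config (current h) ≡ atB → departed h ≡ word y [] (B i) →
                   ∃[ j ] (j ≡ ρ i × config (current (next h)) ≡ enter (toList (Y j)) exit)
      atB-choice h {y} {i} eq dep = ρ i , refl , (begin
        config (current (next h))                             ≡⟨ cong config (current-extend h _) ⟩
        config (tgt (edge-after h))                           ≡⟨ cong (config ∘ tgt) (nextEdge-₁ h v≡) ⟩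
        config (tgt (respond (current h) (departed h)))       ≡⟨ cong₂ (λ v s → config (tgt (respond v s))) v≡ dep ⟩
        config (tgt (respond (inj₁ tt) (word y [] (B i))))    ≡⟨ edge-to-tgt (inj₁ tt) (chooseY (ρ i)) (valid-Y (ρ i)) ⟩
        enter (toList (Y (ρ i))) exit                         ∎)
        where
        open ≡-Reasoning
        v≡ : current h ≡ inj₁ tt
        v≡ = atB-unique (current h) eq

  module _ (i₀ : Fin (suc m)) where

    insist : ∀ v → Dec (config v ≡ atA) → Edge
    insist v (yes eq) = edge-to v (subst (λ s → s ⟶[ a ] _) (sym eq) (chooseX i₀)) (valid-X i₀)
    insist v (no  _)  = default v

    insist-src : ∀ v d → src (insist v d) ≡ v
    insist-src v (yes _) = refl
    insist-src v (no  _) = refl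

    insist-tgt : ∀ v d → config v ≡ atA → config (tgt (insist v d)) ≡ enter (toList (X i₀)) (B i₀)
    insist-tgt v (yes eq) _  = edge-to-tgt v _ (valid-X i₀)
    insist-tgt v (no ¬eq) eq = contradiction eq ¬eq

    insisting : Strategy
    insisting = toStrategy (record { move = λ v → insist v em ; legal = λ v → insist-src v em })

  positional-choice : (τ : PositionalStrategy) → ∃[ j ]
    config (tgt (PositionalStrategy.move τ (inj₁ tt))) ≡ enter (toList (Y j)) exit
  positional-choice τ =
    go (subst (λ v → config v ⟶[ col e ] config (tgt e)) (PositionalStrategy.legal τ (inj₁ tt)) (edge-step e))
    where
    e = PositionalStrategy.move τ (inj₁ tt)

    go : ∀ {y t} → atB ⟶[ y ] t → ∃[ j ] t ≡ enter (toList (Y j)) exit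
    go (chooseY j) = j , refl

  positional-outcome : ∀ τ i₀ q → config q ≡ enter c A →
    Outcome (λ i j → i ≡ i₀ × j ≡ proj₁ (positional-choice τ)) (trace (toStrategy τ) (insisting i₀) q)
  positional-outcome τ i₀ = outcome atA-choice atB-choice
    where
    open Play (toStrategy τ) (insisting i₀)
    j₀ = proj₁ (positional-choice τ)

    atA-choice : ∀ h → config (current h) ≡ atA →
                 ∃[ i ] (i ≡ i₀ × config (current (next h)) ≡ enter (toList (X i)) (B i))
    atA-choice h eq = i₀ , refl , trans (cong config (current-extend h _)) (trans
      (cong (config ∘ tgt) (nextEdge-₂ h (proj₂ (atA-player₂ (current h) eq))))
      (insist-tgt i₀ (current h) em eq))

    atB-choice : ∀ h {y i} → config (current h) ≡ atB → departed h ≡ word y [] (B i) →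
                 ∃[ j ] (j ≡ j₀ × config (current (next h)) ≡ enter (toList (Y j)) exit)
    atB-choice h eq _ = j₀ , refl , trans (cong config (current-extend h _)) (trans
      (cong (config ∘ tgt) (trans (nextEdge-₁ h v≡) (cong (PositionalStrategy.move τ) v≡)))
      (proj₂ (positional-choice τ)))
      where
      v≡ : current h ≡ inj₁ tt
      v≡ = atB-unique (current h) eq

  -- Positionality exchanges the quantifiers: from an answer for each `i` to one answer for all `i`.
  -- The set of initial states is the single vertex `q`, and each `i` is tested by the opponent who
  -- always chooses it.
  uniform-choice : ∀ {L : ωLanguage Σ} → Positional L → (ρ : Fin (suc m) → Fin (suc n)) →
    (∀ {w} → Outcome (λ i j → ⊤ × j ≡ ρ i) w → L w) →
    ∃[ j ] ∀ i → ∃[ w ] (L w × Outcome (λ i′ j′ → i′ ≡ i × j′ ≡ j) w)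
  uniform-choice positional ρ win =
    let q , eq = initial-vertex
        τ , wins = positional arena (λ v → isYes (em {v ≡ q})) (responding ρ) λ v v∈ σ₂ →
          win (responding-outcome ρ σ₂ v (trans (cong config (toWitness v∈)) eq))
    in proj₁ (positional-choice τ) , λ i →
       _ , wins q (fromWitness refl) (insisting i) , positional-outcome τ i q eq

-- Powers, contexts, and groupings of a factorisation

module _ {Σ : Set} where

  power : List Σ → ℕ → List Σ
  power u zero    = []
  power u (suc k) = u ++ power u k

  power-+ : ∀ u k l → power u (k + l) ≡ power u k ++ power u l
  power-+ u zero    l = refl
  power-+ u (suc k) l = trans (cong (u ++_) (power-+ u k l)) (sym (++-assoc u (power u k) (power u l)))

  loop : Mode → List⁺ Σ → List⁺ Σ → List Σ → List⁺ Σ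
  loop linear b z v = z
  loop cyclic b z v = v ++⁺ b

  -- The words c v b z^ω (linear) and c (v b)^ω (cyclic).
  fill : Mode → List Σ → List⁺ Σ → List⁺ Σ → List Σ → ωWord Σ
  fill mode c b z v = flatten (lasso (c ++⁺ (v ++⁺ b)) (loop mode b z v))

  fill≗ : ∀ mode c b z v → fill mode c b z v ≗ (c ++ v ++ toList b) ++ω repeatω (loop mode b z v)
  fill≗ mode c b z v n = trans (flatten-lasso _ (loop mode b z v) n)
    (cong (λ l → (l ++ω repeatω (loop mode b z v)) n)
      (trans (toList-++⁺ c _) (cong (c ++_) (toList-++⁺ v b))))

  absorb : ∀ l {l′ : List Σ} {w w′} x → w ≗ x ++ω w′ → l ++ x ≡ l′ → l ++ω w ≗ l′ ++ω w′
  absorb l {w′ = w′} x w≗ refl n = trans (++ω-cong l w≗ n) (sym (++ω-assoc l x w′ n))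

  -- This is c(xvb)^ω = cx(vbx)^ω. The left factor x recurs in every turn, so it cannot just join
  -- the prefix; rotation also moves it to the end of the period.
  fill-rotate : ∀ c b z x v → fill cyclic c b z (x ++ v) ≗ fill cyclic (c ++ x) (b ⁺++ x) z v
  fill-rotate c b z x v n = begin
    fill cyclic c b z (x ++ v) n                                             ≡⟨ fill≗ cyclic c b z (x ++ v) n ⟩
    ((c ++ (x ++ v) ++ toList b) ++ω repeatω ((x ++ v) ++⁺ b)) n             ≡⟨ absorb (c ++ (x ++ v) ++ toList b) x rotated regroup n ⟩
    (((c ++ x) ++ v ++ toList b ++ x) ++ω repeatω (v ++⁺ (b ⁺++ x))) n       ≡⟨ fill≗ cyclic (c ++ x) (b ⁺++ x) z v n ⟨
    fill cyclic (c ++ x) (b ⁺++ x) z v n                                     ∎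
    where
    open ≡-Reasoning

    rotated : repeatω ((x ++ v) ++⁺ b) ≗ x ++ω repeatω (v ++⁺ (b ⁺++ x))
    rotated = repeatω-rotate x (v ++ toList b)
      (trans (toList-++⁺ (x ++ v) b) (++-assoc x v (toList b)))
      (trans (toList-++⁺ v (b ⁺++ x)) (sym (++-assoc v (toList b) x)))

    regroup : (c ++ (x ++ v) ++ toList b) ++ x ≡ (c ++ x) ++ v ++ toList b ++ x
    regroup = begin
      (c ++ (x ++ v) ++ toList b) ++ x   ≡⟨ ++-assoc c ((x ++ v) ++ toList b) x ⟩
      c ++ ((x ++ v) ++ toList b) ++ x   ≡⟨ cong (c ++_) (++-assoc (x ++ v) (toList b) x) ⟩
      c ++ (x ++ v) ++ toList b ++ x     ≡⟨ cong (c ++_) (++-assoc x v (toList b ++ x)) ⟩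
      c ++ x ++ v ++ toList b ++ x       ≡⟨ ++-assoc c x (v ++ toList b ++ x) ⟨
      (c ++ x) ++ v ++ toList b ++ x     ∎

  segment : (ℕ → List⁺ Σ) → ℕ → ℕ → List Σ
  segment u i zero    = []
  segment u i (suc d) = toList (u i) ++ segment u (suc i) d

  segment-suc : ∀ u i d → segment u i (suc d) ≡ segment u i d ++ toList (u (d + i))
  segment-suc u i zero    = ++-identityʳ (toList (u i))
  segment-suc u i (suc d) = trans (cong (toList (u i) ++_) (segment-suc u (suc i) d)) (trans
    (sym (++-assoc (toList (u i)) (segment u (suc i) d) _))
    (cong (λ j → (toList (u i) ++ segment u (suc i) d) ++ toList (u j)) (+-suc d i)))

  flatten-segment : ∀ u i d → flatten (λ j → u (j + i)) ≗ segment u i d ++ω flatten (λ j → u (j + (d + i)))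
  flatten-segment u i zero    n = refl
  flatten-segment u i (suc d) n = begin
    flatten (λ j → u (j + i)) n
      ≡⟨ flatten-step (λ j → u (j + i)) n ⟩
    (toList (u i) ++ω flatten (λ j → u (suc (j + i)))) n
      ≡⟨ absorb (toList (u i)) (segment u (suc i) d) rest refl n ⟩
    (segment u i (suc d) ++ω flatten (λ j → u (j + suc (d + i)))) n
      ∎
    where
    open ≡-Reasoning

    rest : flatten (λ j → u (suc (j + i))) ≗ segment u (suc i) d ++ω flatten (λ j → u (j + suc (d + i)))
    rest n = trans (flatten-cong (λ j → cong u (sym (+-suc j i))) n) (trans
      (flatten-segment u (suc i) d n)
      (++ω-cong (segment u (suc i) d) (flatten-cong λ j → cong (λ k → u (j + k)) (+-suc d i)) n))

  -- The first block is split off so that a group is nonempty by construction, without a proof of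
  -- `K n < K (suc n)`.
  group : (ℕ → List⁺ Σ) → (ℕ → ℕ) → ℕ → List⁺ Σ
  group u K n = u (K n) ⁺++ segment u (suc (K n)) (K (suc n) ∸ suc (K n))

  toList-group : ∀ u K n → K n < K (suc n) → toList (group u K n) ≡ segment u (K n) (K (suc n) ∸ K n)
  toList-group u K n K< = cong (segment u (K n)) (sym (+-∸-assoc 1 K<))

  flatten-group : ∀ u K → K 0 ≡ 0 → (∀ n → K n < K (suc n)) → flatten u ≗ flatten (group u K)
  flatten-group u K K0 K< n = trans
    (flatten-cong (λ j → cong u (sym (trans (cong (j +_) K0) (+-identityʳ j)))) n)
    (flatten-unique (group u K) (λ i → flatten (λ j → u (j + K i))) step n)
    where
    step : ∀ i → flatten (λ j → u (j + K i)) ≗ toList (group u K i) ++ω flatten (λ j → u (j + K (suc i)))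
    step i n = trans (flatten-segment u (K i) (K (suc i) ∸ K i) n) (trans
      (cong (λ l → (l ++ω flatten (λ j → u (j + (K (suc i) ∸ K i + K i)))) n) (sym (toList-group u K i (K< i))))
      (++ω-cong (toList (group u K i)) (flatten-cong λ j → cong (λ k → u (j + k)) (m∸n+n≡m (<⇒≤ (K< i)))) n))

module _ (P : ℕ → Set) {N p : ℕ}
  (up   : ∀ {k} → N ≤ k → P k → P (suc p + k))
  (down : ∀ {k} → N ≤ k → P (suc p + k) → P k) where

  -- `suc p` consecutive numbers meet every residue class. With `up` the window slides arbitrarily
  -- far to the right, and `down` leads back to `t` in steps of one period.
  window⇒everywhere : ∀ {a} → N ≤ a → (∀ i → i ≤ p → P (i + a)) → ∀ {t} → N ≤ t → P t
  window⇒everywhere {a} N≤a window {t} N≤t =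
    -- Adding `a` periods to `t` gives a number that is at least `a`, whatever `t` is, and hence is
    -- reached by sliding.
    let o , a+o≡ = m≤n⇒∃[o]m+o≡n (≤-trans (m≤m*n a (suc p)) (m≤m+n (a * suc p) t))
    in descend a (subst P (trans (+-comm o a) a+o≡) (slide o 0 z≤n))
    where
    slide : ∀ n i → i ≤ p → P (i + (n + a))
    slide zero    i i≤p = window i i≤p
    slide (suc n) i i≤p with m≤n⇒m<n∨m≡n i≤p
    ... | inj₁ i<p  = subst P (sym (+-suc i (n + a))) (slide n (suc i) i<p)
    ... | inj₂ refl = subst P (sym (+-suc i (n + a))) (up (≤-trans N≤a (m≤n+m a n)) (slide n 0 z≤n))

    descend : ∀ m → P (m * suc p + t) → P t
    descend zero    Pt = Pt
    descend (suc m) Pt = descend m (down (≤-trans N≤t (m≤n+m t _)) (subst P (+-assoc (suc p) (m * suc p) t) Pt))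

-- The syntactic congruence and its monoid

module SyntacticCongruence (em : ExcludedMiddle 0ℓ) {Σ : Set} (L : ωLanguage Σ) (A : BüchiAutomaton Σ)
  (accepts : ∀ w → L w ⇔ BüchiAutomaton.AcceptingRun A w) where

  open Classical em
  open Büchi A

  -- A predicate on functions need not respect pointwise equality; `L` does because a run refers to
  -- single letters only.
  L-cong : ∀ {w w′} → w ≗ w′ → L w → L w′
  L-cong {w} {w′} w≗w′ Lw = Equivalence.from (accepts w′) (record
    { run = run ; starts = starts ; steps = IsRun-cong w≗w′ steps ; recurrent = recurrent })
    where open BüchiAutomaton.AcceptingRun (Equivalence.to (accepts w) Lw)

  -- The states at the block boundaries are kept, and the paths between them are exchanged.
  ∼-saturates : ∀ {w w′} u u′ → w ≗ flatten u → w′ ≗ flatten u′ →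
                (∀ i → toList (u i) ∼ toList (u′ i)) → L w → L w′
  ∼-saturates {w} {w′} u u′ w≗ w′≗ u∼u′ Lw = Equivalence.from (accepts w′)
    (BlockRun⇒accepted em (BlockRun-mono (proj₁ ∘ u∼u′)
      (accepted⇒BlockRun w≗ (Equivalence.to (accepts w) Lw))) w′≗)

  profile : List Σ → Fin (2 ^ proj₁ Profile-finite)
  profile = type Profile-finite Profile

  profile-cong : ∀ {v w} → v ∼ w → profile v ≡ profile w
  profile-cong (v≼w , w≼v) = type-cong Profile-finite Profile λ x → mk⇔ (v≼w x) (w≼v x)

  profile-reflects : ∀ {v w} → profile v ≡ profile w → v ∼ w
  profile-reflects eq = type-reflects Profile-finite Profile eq , type-reflects Profile-finite Profile (sym eq)

  infix 4 _≲_ _≈_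

  -- `b` is nonempty so that `v` followed by `b` can be repeated even for empty `v`.
  _≲_ : List Σ → List Σ → Set
  v ≲ w = ∀ mode c b z → L (fill mode c b z v) → L (fill mode c b z w)

  _≈_ : List Σ → List Σ → Set
  v ≈ w = v ≲ w × w ≲ v

  ≈-refl : ∀ {v} → v ≈ v
  ≈-refl = (λ _ _ _ _ p → p) , (λ _ _ _ _ p → p)

  ≈-sym : ∀ {v w} → v ≈ w → w ≈ v
  ≈-sym (f , g) = g , f

  ≲-trans : ∀ {u v w} → u ≲ v → v ≲ w → u ≲ w
  ≲-trans f g mode c b z = g mode c b z ∘ f mode c b z

  ≈-trans : ∀ {u v w} → u ≈ v → v ≈ w → u ≈ w
  ≈-trans (f , g) (f′ , g′) = ≲-trans f f′ , ≲-trans g′ g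

  ∼⇒≲ : ∀ {v w} → v ∼ w → v ≲ w
  ∼⇒≲ {v} {w} v∼w mode c b z = ∼-saturates _ _ (λ _ → refl) (λ _ → refl)
    λ { zero    → ∼-trans (∼-reflexive (spread v)) (∼-trans
                    (++-cong (∼-refl {c}) (++-cong v∼w (∼-refl {toList b}))) (∼-reflexive (sym (spread w))))
      ; (suc i) → loop-∼ mode }
    where
    spread : ∀ v → toList (c ++⁺ (v ++⁺ b)) ≡ c ++ v ++ toList b
    spread v = trans (toList-++⁺ c (v ++⁺ b)) (cong (c ++_) (toList-++⁺ v b))

    loop-∼ : ∀ mode → toList (loop mode b z v) ∼ toList (loop mode b z w)
    loop-∼ linear = ∼-refl
    loop-∼ cyclic = ∼-trans (∼-reflexive (toList-++⁺ v b)) (∼-trans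
                      (++-cong v∼w (∼-refl {toList b})) (∼-reflexive (sym (toList-++⁺ w b))))

  ∼⇒≈ : ∀ {v w} → v ∼ w → v ≈ w
  ∼⇒≈ v∼w = ∼⇒≲ v∼w , ∼⇒≲ (∼-sym v∼w)

  ++-monoˡ-≲ : ∀ x {v w} → v ≲ w → v ++ x ≲ w ++ x
  ++-monoˡ-≲ x {v} {w} v≲w mode c b z Lv =
    L-cong (shift mode w) (v≲w mode c (x ++⁺ b) z (L-cong (λ n → sym (shift mode v n)) Lv))
    where
    shift : ∀ mode v → fill mode c (x ++⁺ b) z v ≗ fill mode c b z (v ++ x)
    shift linear v n = cong (λ l → flatten (lasso (c ++⁺ l) z) n) (sym (++-++⁺ v))
    shift cyclic v n = cong (λ l → flatten (lasso (c ++⁺ l) l) n) (sym (++-++⁺ v))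

  ++-monoʳ-≲ : ∀ x {v w} → v ≲ w → x ++ v ≲ x ++ w
  ++-monoʳ-≲ x {v} {w} v≲w linear c b z Lv =
    L-cong (shift w) (v≲w linear (c ++ x) b z (L-cong (λ n → sym (shift v n)) Lv))
    where
    shift : ∀ v → fill linear (c ++ x) b z v ≗ fill linear c b z (x ++ v)
    shift v n = cong (λ l → flatten (lasso l z) n)
      (trans (++-++⁺ c) (cong (c ++⁺_) (sym (++-++⁺ x))))
  ++-monoʳ-≲ x {v} {w} v≲w cyclic c b z Lv =
    L-cong (λ n → sym (fill-rotate c b z x w n))
      (v≲w cyclic (c ++ x) (b ⁺++ x) z (L-cong (fill-rotate c b z x v) Lv))

  ++-mono-≲ : ∀ {v v′ w w′} → v ≲ v′ → w ≲ w′ → v ++ w ≲ v′ ++ w′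
  ++-mono-≲ {v′ = v′} {w} v≲v′ w≲w′ = ≲-trans (++-monoˡ-≲ w v≲v′) (++-monoʳ-≲ v′ w≲w′)

  ++-cong-≈ : ∀ {v v′ w w′} → v ≈ v′ → w ≈ w′ → v ++ w ≈ v′ ++ w′
  ++-cong-≈ (f , g) (f′ , g′) = ++-mono-≲ f f′ , ++-mono-≲ g g′

  -- The quotient is formed as a setoid: its elements are the words themselves, and the recognising
  -- homomorphism is the identity.
  syntacticMonoid : Monoid 0ℓ 0ℓ
  syntacticMonoid = record
    { Carrier  = List Σ
    ; _≈_      = _≈_
    ; _∙_      = _++_
    ; ε        = []
    ; isMonoid = record
      { isSemigroup = record
        { isMagma = record
          { isEquivalence = record { refl = ≈-refl ; sym = ≈-sym ; trans = ≈-trans }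
          ; ∙-cong        = ++-cong-≈ }
        ; assoc   = λ u v w → reflexive (++-assoc u v w) }
      ; identity = (λ _ → ≈-refl) , (λ v → reflexive (++-identityʳ v)) }
    }
    where
    reflexive : ∀ {v w} → v ≡ w → v ≈ w
    reflexive refl = ≈-refl

  -- A lasso with period z is first unrolled so that z occurs in the contexts of
  -- ≲; as these leave part of the period fixed, z is replaced in two halves.
  lasso-mono : ∀ {s s′ z z′} → toList s ≲ toList s′ → toList z ≲ toList z′ →
               L (flatten (lasso s z)) → L (flatten (lasso s′ z′))
  lasso-mono {s} {s′} {z} {z′} s≲s′ z≲z′ =
      L-cong shift₄
    ∘ z≲z′ cyclic (S′ ++ Z′) z′ z
    ∘ L-cong shift₃
    ∘ z≲z′ cyclic S′ z z
    ∘ L-cong shift₂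
    ∘ s≲s′ linear [] z z
    ∘ L-cong shift₁
    where
    open ≡-Reasoning
    S = toList s
    S′ = toList s′
    Z = toList z
    Z′ = toList z′

    shift₁ : flatten (lasso s z) ≗ fill linear [] z z S
    shift₁ n = begin
      flatten (lasso s z) n           ≡⟨ flatten-lasso s z n ⟩
      (S ++ω repeatω z) n             ≡⟨ absorb S Z (repeatω-step z) refl n ⟩
      ((S ++ Z) ++ω repeatω z) n      ≡⟨ fill≗ linear [] z z S n ⟨
      fill linear [] z z S n          ∎

    shift₂ : fill linear [] z z S′ ≗ fill cyclic S′ z z Z
    shift₂ n = begin
      fill linear [] z z S′ n                        ≡⟨ fill≗ linear [] z z S′ n ⟩
      ((S′ ++ Z) ++ω repeatω z) n                    ≡⟨ absorb (S′ ++ Z) Z (repeatω-double z) (++-assoc S′ Z Z) n ⟩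
      ((S′ ++ Z ++ Z) ++ω repeatω (Z ++⁺ z)) n       ≡⟨ fill≗ cyclic S′ z z Z n ⟨
      fill cyclic S′ z z Z n                         ∎

    shift₃ : fill cyclic S′ z z Z′ ≗ fill cyclic (S′ ++ Z′) z′ z Z
    shift₃ n = begin
      fill cyclic S′ z z Z′ n                                  ≡⟨ fill≗ cyclic S′ z z Z′ n ⟩
      ((S′ ++ Z′ ++ Z) ++ω repeatω (Z′ ++⁺ z)) n
        ≡⟨ absorb (S′ ++ Z′ ++ Z) Z′ (repeatω-rotate Z′ Z (toList-++⁺ Z′ z) (toList-++⁺ Z z′)) regroup n ⟩
      (((S′ ++ Z′) ++ Z ++ Z′) ++ω repeatω (Z ++⁺ z′)) n       ≡⟨ fill≗ cyclic (S′ ++ Z′) z′ z Z n ⟨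
      fill cyclic (S′ ++ Z′) z′ z Z n                          ∎
      where
      regroup : (S′ ++ Z′ ++ Z) ++ Z′ ≡ (S′ ++ Z′) ++ Z ++ Z′
      regroup = trans (cong (_++ Z′) (sym (++-assoc S′ Z′ Z))) (++-assoc (S′ ++ Z′) Z Z′)

    shift₄ : fill cyclic (S′ ++ Z′) z′ z Z′ ≗ flatten (lasso s′ z′)
    shift₄ n = begin
      fill cyclic (S′ ++ Z′) z′ z Z′ n                             ≡⟨ fill≗ cyclic (S′ ++ Z′) z′ z Z′ n ⟩
      (((S′ ++ Z′) ++ Z′ ++ Z′) ++ω repeatω (Z′ ++⁺ z′)) n
        ≡⟨ absorb ((S′ ++ Z′) ++ Z′) Z′ (repeatω-double z′) (++-assoc (S′ ++ Z′) Z′ Z′) n ⟨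
      (((S′ ++ Z′) ++ Z′) ++ω repeatω z′) n                        ≡⟨ absorb (S′ ++ Z′) Z′ (repeatω-step z′) refl n ⟨
      ((S′ ++ Z′) ++ω repeatω z′) n                                ≡⟨ absorb S′ Z′ (repeatω-step z′) refl n ⟨
      (S′ ++ω repeatω z′) n                                        ≡⟨ flatten-lasso s′ z′ n ⟨
      flatten (lasso s′ z′) n                                      ∎

  segment-≈ : ∀ {u u′ : ℕ → List⁺ Σ} → (∀ i → toList (u i) ≈ toList (u′ i)) →
              ∀ i d → segment u i d ≈ segment u′ i d
  segment-≈ u≈u′ i zero    = ≈-refl
  segment-≈ u≈u′ i (suc d) = ++-cong-≈ (u≈u′ i) (segment-≈ u≈u′ (suc i) d)

  -- Ramsey's theorem for both factorisations at once reduces the claim to lassos.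
  ≈-saturates : ∀ (u u′ : ℕ → List⁺ Σ) → (∀ i → toList (u i) ≈ toList (u′ i)) →
                L (flatten u) → L (flatten u′)
  ≈-saturates u u′ u≈u′ =
      L-cong (λ n → sym (flatten-group u′ K refl K< n))
    ∘ ∼-saturates (lasso (U′ 0) (U′ 1)) U′ (λ _ → refl) (λ _ → refl)
        (λ { zero → ∼-refl ; (suc n) → proj₂ (homogeneous-groups 0 n) })
    ∘ lasso-mono (proj₁ (U≈U′ 0)) (proj₁ (U≈U′ 1))
    ∘ ∼-saturates U (lasso (U 0) (U 1)) (λ _ → refl) (λ _ → refl)
        (λ { zero → ∼-refl ; (suc n) → proj₁ (homogeneous-groups n 0) })
    ∘ L-cong (flatten-group u K refl K<)
    where
    colour : (ℕ → List⁺ Σ) → ℕ → ℕ → Fin (2 ^ proj₁ Profile-finite)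
    colour v i j = profile (segment v i (j ∸ i))

    colours : ℕ → ℕ → Fin (2 ^ proj₁ Profile-finite * 2 ^ proj₁ Profile-finite)
    colours i j = combine (colour u i j) (colour u′ i j)

    -- Both segments grow by the same block `v m`, and equality of profiles is a congruence.
    colour-extend : ∀ v {i j m} → i ≤ m → j ≤ m → colour v i m ≡ colour v j m →
                    colour v i (suc m) ≡ colour v j (suc m)
    colour-extend v {i} {j} {m} i≤m j≤m eq = profile-cong (∼-trans (∼-reflexive (split i≤m)) (∼-trans
      (++-cong (profile-reflects eq) ∼-refl) (∼-reflexive (sym (split j≤m)))))
      where
      split : ∀ {i} → i ≤ m → segment v i (suc m ∸ i) ≡ segment v i (m ∸ i) ++ toList (v m)
      split {i} i≤m = begin
        segment v i (suc m ∸ i)                              ≡⟨ cong (segment v i) (+-∸-assoc 1 i≤m) ⟩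
        segment v i (suc (m ∸ i))                            ≡⟨ segment-suc v i (m ∸ i) ⟩
        segment v i (m ∸ i) ++ toList (v (m ∸ i + i))        ≡⟨ cong (λ k → segment v i (m ∸ i) ++ toList (v k)) (m∸n+n≡m i≤m) ⟩
        segment v i (m ∸ i) ++ toList (v m)                  ∎
        where open ≡-Reasoning

    colours-extend : ∀ {i j m} → i ≤ m → j ≤ m → colours i m ≡ colours j m →
                     colours i (suc m) ≡ colours j (suc m)
    colours-extend {i} {j} {m} i≤m j≤m eq =
      let eq₁ , eq₂ = combine-injective (colour u i m) (colour u′ i m) (colour u j m) (colour u′ j m) eq
      in cong₂ combine (colour-extend u i≤m j≤m eq₁) (colour-extend u′ i≤m j≤m eq₂)

    open Ramsey colours colours-extend

    k : ℕ → ℕ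
    k = proj₁ (proj₂ homogeneous)

    K : ℕ → ℕ
    K zero    = 0
    K (suc n) = k n

    K< : ∀ n → K n < K (suc n)
    K< zero    = proj₁ (proj₂ (proj₂ homogeneous))
    K< (suc n) = proj₁ (proj₂ (proj₂ (proj₂ homogeneous))) n

    U U′ : ℕ → List⁺ Σ
    U  = group u K
    U′ = group u′ K

    same-colours : ∀ m n → colours (k m) (k (suc m)) ≡ colours (k n) (k (suc n))
    same-colours m n = let e = proj₂ (proj₂ (proj₂ (proj₂ homogeneous))) in trans (e m) (sym (e n))

    homogeneous-groups : ∀ m n → toList (U (suc m)) ∼ toList (U (suc n)) ×
                                 toList (U′ (suc m)) ∼ toList (U′ (suc n))
    homogeneous-groups m n =
      let eq₁ , eq₂ = combine-injective (colour u (k m) (k (suc m))) (colour u′ (k m) (k (suc m)))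
                        (colour u (k n) (k (suc n))) (colour u′ (k n) (k (suc n))) (same-colours m n)
      in as-groups u eq₁ , as-groups u′ eq₂
      where
      as-groups : ∀ v → colour v (k m) (k (suc m)) ≡ colour v (k n) (k (suc n)) →
                  toList (group v K (suc m)) ∼ toList (group v K (suc n))
      as-groups v eq = ∼-trans (∼-reflexive (toList-group v K (suc m) (K< (suc m)))) (∼-trans
        (profile-reflects eq) (∼-reflexive (sym (toList-group v K (suc n) (K< (suc n))))))

    U≈U′ : ∀ n → toList (U n) ≈ toList (U′ n)
    U≈U′ n = ++-cong-≈ (u≈u′ (K n)) (segment-≈ u≈u′ (suc (K n)) (K (suc n) ∸ suc (K n)))

  -- Two powers with equal profiles exist by the pigeonhole principle, and multiplying both by
  -- further powers of `u` preserves the equality. The period is written `suc p` to be positive and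
  -- to match the `suc p` choices in the game.
  power-periodic : ∀ u → ∃[ N ] ∃[ p ] ∀ {k} → N ≤ k → power u k ∼ power u (suc p + k)
  power-periodic u with pigeonhole (n<1+n _) (λ (i : Fin (suc (2 ^ proj₁ Profile-finite))) → profile (power u (toℕ i)))
  ... | i , j , i<j , eq with p , 1+i+p≡j ← m≤n⇒∃[o]m+o≡n i<j = toℕ i , p , λ {k} i≤k → periodic k i≤k
    where
    period : suc p + toℕ i ≡ toℕ j
    period = trans (cong suc (+-comm p (toℕ i))) 1+i+p≡j

    periodic : ∀ k → toℕ i ≤ k → power u k ∼ power u (suc p + k)
    periodic k i≤k with d , refl ← m≤n⇒∃[o]m+o≡n i≤k = ∼-trans (∼-reflexive (power-+ u (toℕ i) d)) (∼-trans
      (++-cong (profile-reflects eq) ∼-refl)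
      (∼-reflexive (trans (sym (power-+ u (toℕ j) d))
        (cong (power u) (trans (cong (_+ d) (sym period)) (+-assoc (suc p) (toℕ i) d))))))

  -- Aperiodicity from positionality

  module _ (positional : Positional L) (a : Σ) (as : List Σ) (N p : ℕ)
    (periodic : ∀ {k} → N ≤ k → power (a ∷ as) k ∼ power (a ∷ as) (suc p + k)) where

    private
      u : List Σ
      u = a ∷ as

    module _ (mode : Mode) (c : List Σ) (b z : List⁺ Σ) (r : ℕ) where

      -- a ∷ X i and a ∷ Y j are u^(2 + i) and u^(1 + r + j) b.
      X : Fin (suc p) → List⁺ Σ
      X i = as ++⁺ (a ∷ (as ++ power u (toℕ i)))

      Y : Fin (suc p) → List⁺ Σ
      Y j = as ++⁺ (power u (r + toℕ j) ++⁺ b)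

      open Game em mode a c X Y z

      exponent : Fin (suc p) → Fin (suc p) → ℕ
      exponent i j = (2 + toℕ i) + (suc r + toℕ j)

      round-power : ∀ i j → toList (round i j) ≡ power u (exponent i j) ++ toList b
      round-power i j = begin
        (a ∷ toList (X i)) ++ (a ∷ toList (Y j))                              ≡⟨ cong₂ (λ x y → (a ∷ x) ++ (a ∷ y)) X≡ Y≡ ⟩
        power u (2 + toℕ i) ++ u ++ power u (r + toℕ j) ++ toList b           ≡⟨ cong (power u (2 + toℕ i) ++_) (++-assoc u (power u (r + toℕ j)) (toList b)) ⟨
        power u (2 + toℕ i) ++ power u (suc r + toℕ j) ++ toList b            ≡⟨ ++-assoc (power u (2 + toℕ i)) (power u (suc r + toℕ j)) (toList b) ⟨
        (power u (2 + toℕ i) ++ power u (suc r + toℕ j)) ++ toList b          ≡⟨ cong (_++ toList b) (power-+ u (2 + toℕ i) (suc r + toℕ j)) ⟨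
        power u (exponent i j) ++ toList b                                    ∎
        where
        open ≡-Reasoning

        X≡ : toList (X i) ≡ as ++ u ++ power u (toℕ i)
        X≡ = toList-++⁺ as _

        Y≡ : toList (Y j) ≡ as ++ power u (r + toℕ j) ++ toList b
        Y≡ = trans (toList-++⁺ as _) (cong (as ++_) (toList-++⁺ (power u (r + toℕ j)) b))

      module _ {G : Fin (suc p) → Fin (suc p) → Set} (k : ℕ) {w} (O : Outcome G w)
               (G⇒∼ : ∀ i j → G i j → power u (exponent i j) ∼ power u k) where

        open Outcome O

        private
          round-∼ : ∀ {x} → IsRound G x → toList x ∼ power u k ++ toList b
          round-∼ (i , j , Gij , refl) = ∼-trans (∼-reflexive (round-power i j)) (++-cong (G⇒∼ i j Gij) ∼-refl)

          later-∼ : ∀ mode {x} → IsLater-of mode G x → toList x ∼ toList (loop mode b z (power u k))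
          later-∼ linear refl = ∼-refl
          later-∼ cyclic isR  = ∼-trans (round-∼ isR) (∼-reflexive (sym (toList-++⁺ (power u k) b)))

          first-∼ : toList (c ++⁺ blocks 0) ∼ toList (c ++⁺ (power u k ++⁺ b))
          first-∼ = ∼-trans (∼-reflexive (toList-++⁺ c (blocks 0))) (∼-trans
            (++-cong (∼-refl {c}) (round-∼ first))
            (∼-reflexive (sym (trans (toList-++⁺ c _) (cong (c ++_) (toList-++⁺ (power u k) b))))))

          -- `c` may be empty and so cannot be a block of its own; as in `fill`, it is joined to the
          -- first one.
          blocks′ : ℕ → List⁺ Σ
          blocks′ zero    = c ++⁺ blocks 0
          blocks′ (suc k) = blocks (suc k)

          w≗blocks′ : w ≗ flatten blocks′
          w≗blocks′ n = trans (word≗ n) (trans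
            (absorb c (toList (blocks 0)) (flatten-step blocks) (sym (toList-++⁺ c (blocks 0))) n)
            (sym (flatten-step blocks′ n)))

          blocks-∼ : ∀ i → toList (blocks′ i) ∼ toList (lasso (c ++⁺ (power u k ++⁺ b)) (loop mode b z (power u k)) i)
          blocks-∼ zero    = first-∼
          blocks-∼ (suc i) = later-∼ mode (later i)

        outcome⇒fill : L w → L (fill mode c b z (power u k))
        outcome⇒fill = ∼-saturates _ _ w≗blocks′ (λ _ → refl) blocks-∼

        fill⇒outcome : L (fill mode c b z (power u k)) → L w
        fill⇒outcome = ∼-saturates _ _ (λ _ → refl) w≗blocks′ (∼-sym ∘ blocks-∼)

      -- `opposite i` is p - i, so the exponent is always 3 + r + p, one period above s = 2 + r. The
      -- second copy of `u` in `a ∷ X i` keeps `X i` nonempty even if `u` is a single letter.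
      exponent-opposite : ∀ i → exponent i (opposite i) ≡ suc p + (2 + r)
      exponent-opposite i = begin
        (2 + toℕ i) + (suc r + toℕ (opposite i))         ≡⟨ cong (λ j → (2 + toℕ i) + (suc r + j)) (opposite-prop i) ⟩
        (2 + toℕ i) + (suc r + (p ∸ toℕ i))              ≡⟨ solve 3 (λ i r q → (con 2 :+ i) :+ (con 1 :+ r :+ q) := con 1 :+ (i :+ q) :+ (con 2 :+ r)) refl (toℕ i) r (p ∸ toℕ i) ⟩
        suc (toℕ i + (p ∸ toℕ i)) + (2 + r)              ≡⟨ cong (λ q → suc q + (2 + r)) (m+[n∸m]≡n (toℕ≤pred[n] i)) ⟩
        suc p + (2 + r)                                  ∎
        where open ≡-Reasoning

      -- Replying with `opposite` wins, since every round then has the profile of u^(2 + r) b. Once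
      -- positionality fixes `j`, the exponents for i = 0, ..., p are the consecutive numbers from 3
      -- + r + j on.
      window : N ≤ 2 + r → L (fill mode c b z (power u (2 + r))) →
               ∃[ a ] (N ≤ a × (∀ i → i ≤ p → L (fill mode c b z (power u (i + a)))))
      window N≤s Ls =
        let j , uniform = uniform-choice positional opposite λ O → fill⇒outcome (2 + r) O opposite-∼ Ls
        in 3 + r + toℕ j , ≤-trans N≤s (≤-trans (n≤1+n _) (m≤m+n (3 + r) (toℕ j))) , λ i i≤p →
           let w , Lw , O = uniform (fromℕ< (s≤s i≤p))
           in subst (λ k → L (fill mode c b z (power u k))) (shape i (toℕ j) (toℕ-fromℕ< (s≤s i≤p)))
                (outcome⇒fill (exponent (fromℕ< (s≤s i≤p)) j) O (λ { _ _ (refl , refl) → ∼-refl }) Lw)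
        where
        opposite-∼ : ∀ i j → ⊤ × j ≡ opposite i → power u (exponent i j) ∼ power u (2 + r)
        opposite-∼ i _ (_ , refl) = ∼-trans (∼-reflexive (cong (power u) (exponent-opposite i))) (∼-sym (periodic N≤s))

        shape : ∀ {i′} i j → i′ ≡ i → (2 + i′) + (suc r + j) ≡ i + (3 + r + j)
        shape i j refl = solve 3 (λ i r j → (con 2 :+ i) :+ (con 1 :+ r :+ j) := i :+ (con 3 :+ r :+ j)) refl i r j

    -- The bound on `s` allows it to be written as 2 + r, the form required by the game; `t` only
    -- has to lie in the periodic range.
    power-≲ : ∀ {s t} → 2 + N ≤ s → N ≤ t → power u s ≲ power u t
    power-≲ {suc (suc r)} {t} (s≤s (s≤s N≤r)) N≤t mode c b z Ls =
      let a , N≤a , win = window mode c b z r (≤-trans N≤r (m≤n+m r 2)) Ls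
      in window⇒everywhere (λ k → L (fill mode c b z (power u k)))
           (λ N≤k → ∼⇒≲ (periodic N≤k) mode c b z)
           (λ N≤k → ∼⇒≲ (∼-sym (periodic N≤k)) mode c b z)
           N≤a win N≤t

  aperiodic : Positional L → Aperiodic syntacticMonoid
  -- The game needs a first letter of `u`; for the empty word all powers are empty.
  aperiodic positional []       = 0 , ≈-refl
  aperiodic positional (a ∷ as) =
    let N , p , periodic = power-periodic (a ∷ as)
        powers : ∀ {s t} → 2 + N ≤ s → N ≤ t → power (a ∷ as) s ≲ power (a ∷ as) t
        powers = power-≲ positional a as N p periodic
    -- 2 + N is the least exponent from which `power-≲` may start; it is applied from there to 3 + N
    -- and back.
    in 2 + N , subst₂ _≈_ (power≡× (2 + N)) (power≡× (3 + N))
         (powers ≤-refl (m≤n+m N 3) , powers (n≤1+n _) (m≤n+m N 2))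
    where
    open RawMonoidDefinitions (Monoid.rawMonoid syntacticMonoid) using () renaming (_×_ to _·_)

    power≡× : ∀ n → power (a ∷ as) n ≡ n · (a ∷ as)
    power≡× zero    = refl
    power≡× (suc n) = cong ((a ∷ as) ++_) (power≡× n)

  recognised : RecognisedBy L syntacticMonoid
  recognised = record
    { h              = id
    ; isHomomorphism = record
      { isMagmaHomomorphism = record
        { isRelHomomorphism = record { cong = λ { refl → ≈-refl } }
        ; homo              = λ _ _ → ≈-refl }
      ; ε-homo = ≈-refl }
    ; saturates      = λ u u′ w≗ w′≗ u≈u′ → mk⇔
        (L-cong (sym ∘ w′≗) ∘ ≈-saturates u u′ u≈u′ ∘ L-cong w≗)
        (L-cong (sym ∘ w≗) ∘ ≈-saturates u′ u (≈-sym ∘ u≈u′) ∘ L-cong w′≗)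
    }

theorem5 : ExcludedMiddle 0ℓ →
    (Σ : Set) → Finite Σ → (L : ωLanguage Σ) →
    ωRegular L → Positional L → ωStarFree L
theorem5 em Σ _ L (A , accepts) positional =
    syntacticMonoid
  , Classical.finite-setoid em (Monoid.setoid syntacticMonoid) profile (∼⇒≈ ∘ profile-reflects)
  , aperiodic positional
  , recognised
  where open SyntacticCongruence em L A accepts
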